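{- Let $T$ be a tree of order $n\ge 3$ with $\iota(\mathrm{Mid}(T))=\lfloor \frac{n-1}{2}\rfloor$. Then: (i) if $3\le n\le 4$, $T$ is the path $P_n$ or the star $K_{1,3}$; (ii) if $n\ge 5$ and $n$ is odd, $T$ is the spider $S_k$ with $k=\frac{n-1}{2}\ge 2$; (iii) if $n\ge 6$, $n$ is even and $\mathrm{Diam}(T)\le 4$, then $T$ has a leaf $w$ such that $T-w$ is isomorphic to the spider $S_k$ for some $k\ge 2$; (iv) if $n\ge 6$, $n$ is even and $\mathrm{Diam}(T)\ge 5$, then $T$ is one of the following: (a) a tree obtained from a path $u_0u_1u_2u_3u_4u_5$ by adding some number $r\ge 0$ of new disjoint edges $x_iy_i$ together with an edge joining $x_i$ to a vertex of $\{u_2,u_3\}$ for each $i$; (b) a tree obtained from a path $u_0u_1\cdots u_6$ by adding a new leaf $v$ adjacent to $u_3$ and some number $r\ge 0$ of new disjoint edges $x_iy_i$ together with an edge joining $x_i$ to a vertex of $\{u_2,u_4\}$ for each $i$; (c) a tree obtained from a path $u_0u_1\cdots u_7$ by adding some number $r\ge 0$ of new disjoint edges $x_iy_i$ together with an edge joining $x_i$ to a vertex of $\{u_2,u_5\}$ for each $i$.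
   Context: For a graph $H$ and $S\subseteq V(H)$, let $N_H[S]$ be $S$ together with all vertices adjacent to a vertex of $S$. A set $S\subseteq V(H)$ is an isolating set of $H$ if $V(H)\setminus N_H[S]$ is an independent set of $H$; $\iota(H)$ is the minimum size of an isolating set of $H$. The middle graph $\mathrm{Mid}(G)$ has vertex set $V(G)\cup\{m_e: e\in E(G)\}$, with $v\sim m_e$ iff $v$ is an endpoint of $e$, $m_e\sim m_f$ iff distinct edges $e,f$ share an endpoint, and no edges between vertices of $V(G)$. $\mathrm{Diam}(T)$ is the maximum distance between two vertices of $T$. For $k\ge 2$, the spider $S_k$ is the tree of order $2k+1$ obtained from the star $K_{1,k}$ by subdividing each edge exactly once (a center adjacent to $k$ vertices of degree 2, each adjacent to a distinct leaf). -}

module Defs where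

open import Data.Nat using (ℕ; zero; suc; _+_; _*_; _∸_; _≤_; _≡ᵇ_; pred)
open import Data.Bool using (Bool; true; false; T; _∧_; _∨_)
open import Data.Bool.ListAction using (any)
open import Data.Fin using (Fin; toℕ; punchIn) renaming (_<_ to _<ᶠ_)
open import Data.List using (List; []; _∷_; _++_; length; map; upTo; allFin; concat)
open import Data.List.Membership.Propositional using (_∈_)
open import Data.List.Relation.Unary.Unique.Propositional using (Unique)
open import Data.List.Relation.Unary.Linked using (Linked)
open import Data.Product using (Σ; ∃; _×_; _,_; proj₁; proj₂)
open import Data.Sum using (_⊎_; inj₁; inj₂)
open import Data.Empty using (⊥)
open import Relation.Nullary using (¬_)
open import Relation.Binary.PropositionalEquality using (_≡_)
open import Function.Bundles using (_⤖_; Bijection)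

Graph : ℕ → Set
Graph n = Fin n → Fin n → Bool

Adj : ∀ {n} → Graph n → Fin n → Fin n → Set
Adj G u v = T (G u v)

IsSimple : ∀ {n} → Graph n → Set
IsSimple G = (∀ u v → G u v ≡ G v u) × (∀ u → G u u ≡ false)

data Walk {n} (G : Graph n) : Fin n → Fin n → ℕ → Set where
  nil  : ∀ {u} → Walk G u u 0
  cons : ∀ {u v w k} → Adj G u v → Walk G v w k → Walk G u w (suc k)

Connected : ∀ {n} → Graph n → Set
Connected G = ∀ u v → ∃ λ k → Walk G u v k

IsCycle : ∀ {n} → Graph n → Fin n → List (Fin n) → Set
IsCycle G u vs =
  (2 ≤ length vs) × Unique (u ∷ vs) × Linked (Adj G) (u ∷ vs ++ u ∷ [])

Acyclic : ∀ {n} → Graph n → Set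
Acyclic G = ∀ u vs → ¬ IsCycle G u vs

IsTree : ∀ {n} → Graph n → Set
IsTree G = IsSimple G × Connected G × Acyclic G

DistLe : ∀ {n} → Graph n → Fin n → Fin n → ℕ → Set
DistLe G u v d = ∃ λ k → k ≤ d × Walk G u v k

DiamLe : ∀ {n} → Graph n → ℕ → Set
DiamLe G d = ∀ u v → DistLe G u v d

DiamGt : ∀ {n} → Graph n → ℕ → Set
DiamGt G d = ∃ λ u → ∃ λ v → ¬ DistLe G u v d

IsLeaf : ∀ {n} → Graph n → Fin n → Set
IsLeaf G w = ∃ λ u → Adj G w u × (∀ v → Adj G w v → v ≡ u)

removeVertex : ∀ {n} → Graph n → Fin n → Graph (pred n)
removeVertex {suc m} G w a b = G (punchIn w a) (punchIn w b)

Iso : ∀ {n m} → Graph n → Graph m → Set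
Iso {n} {m} G H =
  Σ (Fin n ⤖ Fin m) λ f → ∀ a b → G a b ≡ H (Bijection.to f a) (Bijection.to f b)

edgeGraph : (N : ℕ) → List (ℕ × ℕ) → Graph N
edgeGraph N es a b =
  any (λ e → ((proj₁ e ≡ᵇ toℕ a) ∧ (proj₂ e ≡ᵇ toℕ b))
           ∨ ((proj₁ e ≡ᵇ toℕ b) ∧ (proj₂ e ≡ᵇ toℕ a))) es

pathEdges : ℕ → List (ℕ × ℕ)
pathEdges n = map (λ i → i , suc i) (upTo (n ∸ 1))

pathGraph : (n : ℕ) → Graph n
pathGraph n = edgeGraph n (pathEdges n)

star13 : Graph 4
star13 = edgeGraph 4 ((0 , 1) ∷ (0 , 2) ∷ (0 , 3) ∷ [])

-- spider S_k : center 0, middle vertices 1+i, leaves 1+k+i (i < k)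
spider : (k : ℕ) → Graph (2 * k + 1)
spider k = edgeGraph (2 * k + 1)
  (concat (map (λ i → (0 , suc i) ∷ (suc i , suc (k + i)) ∷ []) (upTo k)))

-- pendant paths x_i y_i (x_i = base + i, y_i = base + r + i), x_i joined to
-- vertex p if c i = true and to vertex q if c i = false
pendants : (base p q r : ℕ) → (Fin r → Bool) → List (ℕ × ℕ)
pendants base p q r c = concat (map (λ i →
    (base + toℕ i , base + r + toℕ i)
  ∷ ((if' (c i) p q) , base + toℕ i) ∷ []) (allFin r))
  where
  if' : Bool → ℕ → ℕ → ℕ
  if' true  x _ = x
  if' false _ y = y

familyA : (r : ℕ) → (Fin r → Bool) → Graph (6 + r + r)
familyA r c = edgeGraph (6 + r + r) (pathEdges 6 ++ pendants 6 2 3 r c)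

familyB : (r : ℕ) → (Fin r → Bool) → Graph (8 + r + r)
familyB r c = edgeGraph (8 + r + r)
  (pathEdges 7 ++ (3 , 7) ∷ pendants 8 2 4 r c)

familyC : (r : ℕ) → (Fin r → Bool) → Graph (8 + r + r)
familyC r c = edgeGraph (8 + r + r) (pathEdges 8 ++ pendants 8 2 5 r c)

Edge : ∀ {n} → Graph n → Set
Edge {n} G = Σ (Fin n × Fin n) λ p → (proj₁ p <ᶠ proj₂ p) × Adj G (proj₁ p) (proj₂ p)

IsEnd : ∀ {n} {G : Graph n} → Fin n → Edge G → Set
IsEnd v e = v ≡ proj₁ (proj₁ e) ⊎ v ≡ proj₂ (proj₁ e)

MidV : ∀ {n} → Graph n → Set
MidV {n} G = Fin n ⊎ Edge G

MidAdj : ∀ {n} (G : Graph n) → MidV G → MidV G → Set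
MidAdj G (inj₁ _) (inj₁ _) = ⊥
MidAdj G (inj₁ v) (inj₂ e) = IsEnd {G = G} v e
MidAdj G (inj₂ e) (inj₁ v) = IsEnd {G = G} v e
MidAdj {n} G (inj₂ e) (inj₂ f) =
  ¬ e ≡ f × ∃ λ (v : Fin n) → IsEnd {G = G} v e × IsEnd {G = G} v f

module _ {V : Set} (adj : V → V → Set) where

  ClosedNbhd : List V → V → Set
  ClosedNbhd S v = v ∈ S ⊎ ∃ λ s → s ∈ S × adj s v

  IsIsolating : List V → Set
  IsIsolating S = ∀ u v → ¬ ClosedNbhd S u → ¬ ClosedNbhd S v → ¬ adj u v

  IsolationNumber : ℕ → Set
  IsolationNumber k =
    (∃ λ S → Unique S × IsIsolating S × length S ≡ k)
    × (∀ S → Unique S → IsIsolating S → k ≤ length S)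

{-# OPTIONS --safe #-}
module Submission where

open import Defs
open import Algebra.Bundles using (CommutativeMonoid)
import Algebra.Construct.DirectProduct as DirectProduct
import Algebra.Solver.CommutativeMonoid as CommutativeMonoidSolver
open import Data.Bool using (Bool; true; false; if_then_else_; _∧_; _∨_) renaming (T to IsTrue)
open import Data.Bool.Properties using (T-irrelevant; T-∨; T-∧)
open import Data.Empty using (⊥-elim)
open import Data.Fin using (Fin; toℕ; fromℕ<; punchIn; punchOut)
import Data.Fin as Fin
open import Data.Fin.Properties using (<-irrelevant; toℕ-fromℕ<; toℕ-injective; toℕ<n; punchIn-injective; punchInᵢ≢i; punchIn-punchOut) renaming (_≟_ to _≟ᶠ_; <-cmp to <ᶠ-cmp)
open import Data.List using (List; []; _∷_; _++_; length; map; concat; upTo; applyUpTo; allFin; tabulate; lookup; deduplicate)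
open import Data.List.Properties using (length-++; length-map; length-tabulate; length-deduplicate; ++-identityʳ; map-tabulate; tabulate-lookup)
open import Data.List.Membership.Propositional using (_∈_; _∉_)
open import Data.List.Membership.Propositional.Properties using (∈-++⁺ˡ; ∈-++⁺ʳ; ∈-++⁻; ∈-allFin; ∈-deduplicate⁺)
open import Data.List.Membership.Propositional.Properties.WithK using (unique∧set⇒bag)
open import Data.List.Relation.Binary.BagAndSetEquality using (∼bag⇒↭)
open import Data.List.Relation.Binary.Permutation.Propositional using (_↭_; ↭-refl; ↭-sym; swap; ↭⇒↭ₛ)
open import Data.List.Relation.Binary.Permutation.Propositional.Properties using (++-commutativeMonoid; ++-comm; All-resp-↭; ∈-resp-↭; ↭-length)
import Data.List.Relation.Binary.Permutation.Setoid.Properties as PermutationSetoid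
open import Data.List.Relation.Binary.Pointwise using (Pointwise; []; _∷_) renaming (++⁺ to Pointwise-++⁺; map to Pointwise-map)
open import Data.List.Relation.Binary.Sublist.Propositional using ([]; _∷_; _∷ʳ_; minimum; ⊆-refl) renaming (_⊆_ to _⊑_)
open import Data.List.Relation.Binary.Sublist.Propositional.Properties using (All-resp-⊆; ++⁺ˡ; ++⁺ʳ)
open import Data.List.Relation.Unary.All as All using (All; []; _∷_)
import Data.List.Relation.Unary.All.Properties as All
open import Data.List.Relation.Unary.AllPairs using ([]; _∷_)
open import Data.List.Relation.Unary.Any using (Any; here; there; any?)
import Data.List.Relation.Unary.Any.Properties as Any
open import Data.List.Relation.Unary.Linked using (Linked; [-]; _∷_)
open import Data.List.Relation.Unary.Unique.DecPropositional.Properties using (deduplicate-!)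
open import Data.List.Relation.Unary.Unique.Propositional using (Unique)
open import Data.List.Relation.Unary.Unique.Propositional.Properties using (allFin⁺; Unique[x∷xs]⇒x∉xs)
open import Data.Nat using (ℕ; zero; suc; _+_; _*_; _∸_; _≤_; _<_; _≡ᵇ_; z≤n; s≤s)
open import Data.Nat.DivMod using (_/_; _%_; m*n/n≡m; /-monoˡ-≤; [m+kn]%n≡m%n)
open import Data.Nat.Properties using (≤-trans; ≤-refl; ≤-reflexive; +-mono-≤; +-monoʳ-≤; +-monoˡ-≤; +-comm; +-assoc; +-suc; n≤1+n; m≤n⇒m≤1+n; <⇒≱; <-irrefl; ∸-monoˡ-≤; ≡ᵇ⇒≡; ≡⇒≡ᵇ; module ≤-Reasoning)
open import Data.Nat.Solver using (module +-*-Solver)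
open import Data.Product using (∃; _×_; _,_; proj₁; proj₂)
import Data.Product.Properties as Product
open import Data.Sum using (_⊎_; inj₁; inj₂) renaming (map to ⊎-map; map₁ to ⊎-map₁)
open import Data.Sum.Properties using (≡-dec)
open import Function using (_∘_; mk⇔)
open import Function.Bundles using (Bijection; mk⤖; Equivalence)
open import Relation.Binary.Definitions using (tri<; tri≈; tri>)
open import Relation.Binary.PropositionalEquality using (_≡_; _≢_; refl; sym; trans; cong; cong₂; subst; module ≡-Reasoning) renaming (setoid to ≡-setoid)
open import Relation.Nullary using (¬_; Dec; yes; no; contradiction)

-- A set S of vertices of Mid(T) is isolating iff the vertices of T it contains, together
-- with the endpoints of the edges it contains, form a vertex cover of T.  So the hypothesis
-- says that no set F of edges whose endpoints form a vertex cover of T satisfies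
-- 2|F| + 3 ≤ n.
--
-- Choose adjacent vertices v, x such that all other neighbours of x are leaves and there is
-- at least one of them (the parents of deepest leaves are such x).  Put vx into F: it
-- dominates all edges at v and x, and leaves every leaf at x uncovered, so what remains is
-- to choose F on each component of T - {v, x} other than these leaves.  A component is a
-- single edge or admits a choice that leaves a vertex uncovered (repeat the argument inside
-- the component); it is a single edge or a spider or admits a choice that leaves two
-- vertices uncovered.  At most two uncovered vertices are allowed in total, hence either
-- x has two leaves and all components are edges, or x has one leaf and all components but
-- at most one are edges, the exceptional one being a spider, which v meets at its centre
-- (family A), at a neighbour of the centre (family B) or at a leaf (family C).

-- Shapes: graphs as multisets of vertices and arcs

-- A graph is kept as two lists up to permutation. Union is then a commutative monoid operation, so
-- rearrangements of a tree are identities left to the monoid solver.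
shapes : Set → CommutativeMonoid _ _
shapes V = DirectProduct.commutativeMonoid (++-commutativeMonoid {A = V}) (++-commutativeMonoid {A = V × V})

module _ {V : Set} where

  open CommutativeMonoid (shapes V) public using (_≈_; ε)
    renaming (Carrier to Shape; _∙_ to infixr 5 _⊕_; refl to ≈-refl; sym to ≈-sym; trans to ≈-trans; ∙-cong to ⊕-cong)
  open CommutativeMonoid (shapes V) using (setoid; ∙-congˡ; ∙-congʳ; identityʳ)
  open CommutativeMonoidSolver (shapes V) using (solve; _⊜_) renaming (_⊕_ to _⊞_; id to ∅)
  open import Relation.Binary.Reasoning.Setoid setoid

  -- Every edge is listed in both orientations, so that ↭ disregards orientation.
  verts : Shape → List V
  verts = proj₁

  arcs : Shape → List (V × V)
  arcs = proj₂

  pt : V → Shape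
  pt v = v ∷ [] , []

  link : V → V → Shape
  link a b = [] , (a , b) ∷ (b , a) ∷ []

  link-sym : ∀ a b → link a b ≈ link b a
  link-sym a b = ↭-refl , swap (a , b) (b , a) ↭-refl

  -- br x us ts: first tree with root x and subtrees us, followed by the trees ts.
  data Forest : Set where
    nil : Forest
    br  : V → Forest → Forest → Forest

  -- The root `v` itself is left out, which makes `hang v` additive in the forest (`hang-++`).
  hang : V → Forest → Shape
  hang v nil          = ε
  hang v (br x us ts) = link v x ⊕ ((pt x ⊕ hang x us) ⊕ hang v ts)

  tree : V → Forest → Shape
  tree v f = pt v ⊕ hang v f

  _++ᶠ_ : Forest → Forest → Forest
  nil          ++ᶠ g = g
  (br x us ts) ++ᶠ g = br x us (ts ++ᶠ g)

  leaves : List V → Forest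
  leaves []       = nil
  leaves (y ∷ ys) = br y nil (leaves ys)

  hang-++ : ∀ v f g → hang v (f ++ᶠ g) ≈ hang v f ⊕ hang v g
  hang-++ v nil          g = ≈-refl
  hang-++ v (br x us ts) g = begin
    link v x ⊕ ((pt x ⊕ hang x us) ⊕ hang v (ts ++ᶠ g))
      ≈⟨ ∙-congˡ {link v x} (∙-congˡ {pt x ⊕ hang x us} (hang-++ v ts g)) ⟩
    link v x ⊕ ((pt x ⊕ hang x us) ⊕ (hang v ts ⊕ hang v g))
      ≈⟨ solve 4 (λ l s t u → l ⊞ (s ⊞ (t ⊞ u)) ⊜ (l ⊞ (s ⊞ t)) ⊞ u) ≈-refl
           (link v x) (pt x ⊕ hang x us) (hang v ts) (hang v g) ⟩
    hang v (br x us ts) ⊕ hang v g ∎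

  hang-++-comm : ∀ v f g → hang v (f ++ᶠ g) ≈ hang v (g ++ᶠ f)
  hang-++-comm v f g = begin
    hang v (f ++ᶠ g)       ≈⟨ hang-++ v f g ⟩
    hang v f ⊕ hang v g    ≈⟨ CommutativeMonoid.comm (shapes V) (hang v f) (hang v g) ⟩
    hang v g ⊕ hang v f    ≈⟨ hang-++ v g f ⟨
    hang v (g ++ᶠ f)       ∎

  tree-cong : ∀ v f g → hang v f ≈ hang v g → tree v f ≈ tree v g
  tree-cong v f g = ∙-congˡ {pt v} {hang v f} {hang v g}

  br-cong : ∀ v x us us′ ts → hang x us ≈ hang x us′ → tree v (br x us ts) ≈ tree v (br x us′ ts)
  br-cong v x us us′ ts eq = tree-cong v (br x us ts) (br x us′ ts) (∙-congˡ {link v x} (∙-congʳ {hang v ts} (∙-congˡ {pt x} eq)))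

  rotate : ∀ v x us ts → tree v (br x us ts) ≈ tree x (br v ts us)
  rotate v x us ts = begin
    pt v ⊕ (link v x ⊕ ((pt x ⊕ hang x us) ⊕ hang v ts))
      ≈⟨ ∙-congˡ {pt v} (∙-congʳ {(pt x ⊕ hang x us) ⊕ hang v ts} (link-sym v x)) ⟩
    pt v ⊕ (link x v ⊕ ((pt x ⊕ hang x us) ⊕ hang v ts))
      ≈⟨ solve 5 (λ a l b s t → a ⊞ (l ⊞ ((b ⊞ s) ⊞ t)) ⊜ b ⊞ (l ⊞ ((a ⊞ t) ⊞ s))) ≈-refl
           (pt v) (link x v) (pt x) (hang x us) (hang v ts) ⟩
    pt x ⊕ (link x v ⊕ ((pt v ⊕ hang v ts) ⊕ hang x us)) ∎

  -- `e` holds the siblings already passed. Entering `us` turns the old root into one more subtree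
  -- of `x`; moving on to `ts` adds the first tree to `e`. The recursion thus stays structural in
  -- `f`.
  reroot-++ : ∀ v f e {u} → u ∈ verts (hang v f) → ∃ λ g → tree v (f ++ᶠ e) ≈ tree u g
  reroot-++ v (br x us ts) e (here refl) = br v (ts ++ᶠ e) us , rotate v x us (ts ++ᶠ e)
  reroot-++ v (br x us ts) e (there u∈) with ∈-++⁻ (verts (hang x us)) u∈
  ... | inj₁ u∈us with reroot-++ x us (br v (ts ++ᶠ e) nil) u∈us
  ...   | g , eq = g , (begin
    tree v (br x us (ts ++ᶠ e))          ≈⟨ rotate v x us (ts ++ᶠ e) ⟩
    tree x (br v (ts ++ᶠ e) nil ++ᶠ us)  ≈⟨ tree-cong x (br v (ts ++ᶠ e) us) (us ++ᶠ br v (ts ++ᶠ e) nil) (hang-++-comm x (br v (ts ++ᶠ e) nil) us) ⟩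
    tree x (us ++ᶠ br v (ts ++ᶠ e) nil)  ≈⟨ eq ⟩
    tree _ g                             ∎)
  reroot-++ v (br x us ts) e (there u∈) | inj₂ u∈ts with reroot-++ v ts (e ++ᶠ br x us nil) u∈ts
  ...   | g , eq = g , (begin
    tree v (br x us nil ++ᶠ (ts ++ᶠ e))  ≈⟨ tree-cong v (br x us (ts ++ᶠ e)) ((ts ++ᶠ e) ++ᶠ br x us nil) (hang-++-comm v (br x us nil) (ts ++ᶠ e)) ⟩
    tree v ((ts ++ᶠ e) ++ᶠ br x us nil)  ≡⟨ cong (tree v) (++ᶠ-assoc ts) ⟩
    tree v (ts ++ᶠ (e ++ᶠ br x us nil))  ≈⟨ eq ⟩
    tree _ g                             ∎)
    where
    ++ᶠ-assoc : ∀ f {g h} → (f ++ᶠ g) ++ᶠ h ≡ f ++ᶠ (g ++ᶠ h)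
    ++ᶠ-assoc nil          = refl
    ++ᶠ-assoc (br x us ts) = cong (br x us) (++ᶠ-assoc ts)

  ++ᶠ-nil : ∀ f → f ++ᶠ nil ≡ f
  ++ᶠ-nil nil          = refl
  ++ᶠ-nil (br x us ts) = cong (br x us) (++ᶠ-nil ts)

  reroot : ∀ v f {u} → u ∈ verts (tree v f) → ∃ λ g → tree v f ≈ tree u g
  reroot v f (here refl) = f , ≈-refl
  reroot v f (there u∈) with reroot-++ v f nil u∈
  ... | g , eq = g , subst (λ h → tree v h ≈ tree _ g) (++ᶠ-nil f) eq

  -- Brooms

  -- In the overview, `hub` is v and `joint` is x. The separate `tip` records that at least one leaf
  -- hangs at x.
  record Broom (s : Shape) : Set where
    constructor broom
    field
      {hub joint}  : V
      tip          : V
      tips         : List V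
      rest         : Forest
      shape        : s ≈ tree hub (br joint (leaves (tip ∷ tips)) rest)

  Broom-resp : ∀ {s t} → s ≈ t → Broom t → Broom s
  Broom-resp eq (broom y ys ts eq′) = broom y ys ts (≈-trans eq eq′)

  -- Descends with the current vertex as root; acc holds the leaf children of x seen so far.
  find-broom : ∀ v x us acc ts → (us ≡ nil → acc ≢ []) → Broom (tree v (br x (us ++ᶠ leaves acc) ts))
  find-broom v x nil []        ts ne = contradiction refl (ne refl)
  find-broom v x nil (y ∷ acc) ts ne = broom y acc ts ≈-refl
  find-broom v x (br y nil rest) acc ts ne =
    Broom-resp (br-cong v x (br y nil (rest ++ᶠ leaves acc)) (rest ++ᶠ br y nil (leaves acc)) ts move) (find-broom v x rest (y ∷ acc) ts λ _ ())
    where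
    move : hang x (br y nil (rest ++ᶠ leaves acc)) ≈ hang x (rest ++ᶠ br y nil (leaves acc))
    move = begin
      link x y ⊕ ((pt y ⊕ ε) ⊕ hang x (rest ++ᶠ leaves acc))
        ≈⟨ ∙-congˡ {link x y} (∙-congˡ {pt y ⊕ ε} (hang-++ x rest (leaves acc))) ⟩
      link x y ⊕ ((pt y ⊕ ε) ⊕ (hang x rest ⊕ hang x (leaves acc)))
        ≈⟨ solve 4 (λ l p r a → l ⊞ (p ⊞ (r ⊞ a)) ⊜ r ⊞ (l ⊞ (p ⊞ a))) ≈-refl
             (link x y) (pt y ⊕ ε) (hang x rest) (hang x (leaves acc)) ⟩
      hang x rest ⊕ hang x (br y nil (leaves acc))
        ≈⟨ hang-++ x rest (br y nil (leaves acc)) ⟨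
      hang x (rest ++ᶠ br y nil (leaves acc)) ∎
  find-broom v x (br y us@(br _ _ _) rest) acc ts ne =
    Broom-resp turn (find-broom x y us [] (br v ts nil ++ᶠ (rest ++ᶠ leaves acc)) λ ())
    where
    turn : tree v (br x (br y us (rest ++ᶠ leaves acc)) ts)
         ≈ tree x (br y (us ++ᶠ nil) (br v ts (rest ++ᶠ leaves acc)))
    turn = begin
      tree v (br x (br y us (rest ++ᶠ leaves acc)) ts)
        ≈⟨ rotate v x (br y us (rest ++ᶠ leaves acc)) ts ⟩
      tree x (br v ts nil ++ᶠ (br y us nil ++ᶠ (rest ++ᶠ leaves acc)))
        ≈⟨ tree-cong x (br v ts (br y us (rest ++ᶠ leaves acc))) (br y us (br v ts (rest ++ᶠ leaves acc))) (solve 5 (λ k p l q r → k ⊞ (p ⊞ (l ⊞ (q ⊞ r))) ⊜ l ⊞ (q ⊞ (k ⊞ (p ⊞ r)))) ≈-refl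
             (link x v) (pt v ⊕ hang v ts) (link x y) (pt y ⊕ hang y us) (hang x (rest ++ᶠ leaves acc))) ⟩
      tree x (br y us (br v ts (rest ++ᶠ leaves acc)))
        ≡⟨ cong (λ f → tree x (br y f (br v ts (rest ++ᶠ leaves acc)))) (++ᶠ-nil us) ⟨
      tree x (br y (us ++ᶠ nil) (br v ts (rest ++ᶠ leaves acc))) ∎

  find-broom′ : ∀ v x y us us′ ts → Broom (tree v (br x (br y us us′) ts))
  find-broom′ v x y us us′ ts =
    subst (λ f → Broom (tree v (br x f ts))) (++ᶠ-nil (br y us us′)) (find-broom v x (br y us us′) [] ts λ ())

  -- A tree on three or more vertices contains a path with two edges. If the root is its middle,
  -- rotating to the leaf `x` makes `v` a child with a child of its own, and the search can start
  -- there.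
  small-or-broom : ∀ v f → f ≡ nil ⊎ (∃ λ y → f ≡ br y nil nil) ⊎ Broom (tree v f)
  small-or-broom v nil                       = inj₁ refl
  small-or-broom v (br x nil nil)            = inj₂ (inj₁ (x , refl))
  small-or-broom v (br x nil (br y us ts))   =
    inj₂ (inj₂ (Broom-resp (rotate v x nil (br y us ts)) (find-broom′ x v y us ts nil)))
  small-or-broom v (br x (br y us us′) ts)   = inj₂ (inj₂ (find-broom′ v x y us us′ ts))

  -- Dominating edge sets

  Touches : List (V × V) → V → Set
  Touches F a = Any (λ e → a ≡ proj₁ e ⊎ a ≡ proj₂ e) F

  Dominates : List (V × V) → V × V → Set
  Dominates F (a , b) = Touches F a ⊎ Touches F b

  -- The edges of a dominating set leave at least d vertices uncovered.
  record Surplus (s : Shape) (d : ℕ) : Set where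
    constructor surplus
    field
      edges      : List (V × V)
      edges⊆arcs : All (_∈ arcs s) edges
      dominating : All (Dominates edges) (arcs s)
      bound      : 2 * length edges + d ≤ length (verts s)

  Surplus-resp : ∀ {s t} → s ≈ t → ∀ {d} → Surplus s d → Surplus t d
  Surplus-resp (vs , as) {d} (surplus F F⊆ dom bd) = surplus F
    (All.map (∈-resp-↭ as) F⊆)
    (All-resp-↭ as dom)
    (subst (2 * length F + d ≤_) (↭-length vs) bd)

  Surplus-≤ : ∀ {s d e} → e ≤ d → Surplus s d → Surplus s e
  Surplus-≤ e≤d (surplus F F⊆ dom bd) =
    surplus F F⊆ dom (≤-trans (+-monoʳ-≤ (2 * length F) e≤d) bd)

  Surplus-ε : Surplus ε 0
  Surplus-ε = surplus [] [] [] z≤n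

  Surplus-⊕ : ∀ s t {d e} → Surplus s d → Surplus t e → Surplus (s ⊕ t) (d + e)
  Surplus-⊕ s t {d} {e} (surplus F F⊆ domF bdF) (surplus G G⊆ domG bdG) = surplus (F ++ G)
    (All.++⁺ (All.map ∈-++⁺ˡ F⊆) (All.map (∈-++⁺ʳ (arcs s)) G⊆))
    (All.++⁺ (All.map (⊎-map Any.++⁺ˡ Any.++⁺ˡ) domF) (All.map (⊎-map (Any.++⁺ʳ F) (Any.++⁺ʳ F)) domG))
    (≤-trans (≤-reflexive eq) (≤-trans (+-mono-≤ bdF bdG) (≤-reflexive (sym (length-++ (verts s))))))
    where
    eq : 2 * length (F ++ G) + (d + e) ≡ (2 * length F + d) + (2 * length G + e)
    eq rewrite length-++ F {G} = ℕ-solve 4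
      (λ f g d e → con 2 :* (f :+ g) :+ (d :+ e) := (con 2 :* f :+ d) :+ (con 2 :* g :+ e)) refl
      (length F) (length G) d e
      where open +-*-Solver using (con; _:*_; _:+_; _:=_) renaming (solve to ℕ-solve)

  -- With `links`, this separates the components left by deleting the root from the edges that join
  -- the root to them.
  comps : Forest → Shape
  comps nil          = ε
  comps (br x us ts) = tree x us ⊕ comps ts

  links : V → Forest → Shape
  links v nil          = ε
  links v (br x us ts) = link v x ⊕ links v ts

  hang-split : ∀ v f → hang v f ≈ links v f ⊕ comps f
  hang-split v nil          = ≈-refl
  hang-split v (br x us ts) = begin
    link v x ⊕ (tree x us ⊕ hang v ts)
      ≈⟨ ∙-congˡ {link v x} (∙-congˡ {tree x us} (hang-split v ts)) ⟩
    link v x ⊕ (tree x us ⊕ (links v ts ⊕ comps ts))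
      ≈⟨ solve 4 (λ l t k c → l ⊞ (t ⊞ (k ⊞ c)) ⊜ (l ⊞ k) ⊞ (t ⊞ c)) ≈-refl
           (link v x) (tree x us) (links v ts) (comps ts) ⟩
    links v (br x us ts) ⊕ comps (br x us ts) ∎

  -- Choosing the edge v x dominates every edge at v or x, so only the components
  -- left by deleting v and x remain to be dominated.
  Surplus-tree : ∀ v x us ts {d e} → Surplus (comps us) d → Surplus (comps ts) e →
                 Surplus (tree v (br x us ts)) (d + e)
  Surplus-tree v x us ts {d} {e} Sus Sts = Surplus-resp (≈-sym split) (extend (Surplus-⊕ (comps us) (comps ts) Sus Sts))
    where
    core = (pt v ⊕ pt x) ⊕ (link v x ⊕ (links x us ⊕ links v ts))

    split : tree v (br x us ts) ≈ core ⊕ (comps us ⊕ comps ts)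
    split = begin
      pt v ⊕ (link v x ⊕ ((pt x ⊕ hang x us) ⊕ hang v ts))
        ≈⟨ ∙-congˡ {pt v} (∙-congˡ {link v x} (⊕-cong (∙-congˡ {pt x} (hang-split x us)) (hang-split v ts))) ⟩
      pt v ⊕ (link v x ⊕ ((pt x ⊕ (links x us ⊕ comps us)) ⊕ (links v ts ⊕ comps ts)))
        ≈⟨ solve 7 (λ a l b k c m e → a ⊞ (l ⊞ ((b ⊞ (k ⊞ c)) ⊞ (m ⊞ e))) ⊜ ((a ⊞ b) ⊞ (l ⊞ (k ⊞ m))) ⊞ (c ⊞ e)) ≈-refl
             (pt v) (link v x) (pt x) (links x us) (comps us) (links v ts) (comps ts) ⟩
      core ⊕ (comps us ⊕ comps ts) ∎

    no-verts : ∀ w f → verts (links w f) ≡ []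
    no-verts w nil          = refl
    no-verts w (br _ _ ts)  = no-verts w ts

    at-hub : ∀ F {w} f → Touches F w → All (Dominates F) (arcs (links w f))
    at-hub F nil         t = []
    at-hub F (br _ _ ts) t = inj₁ t ∷ inj₂ t ∷ at-hub F ts t

    extend : ∀ {s k} → Surplus s k → Surplus (core ⊕ s) k
    extend {s} {k} (surplus F F⊆ dom bd) = surplus ((v , x) ∷ F)
      (here refl ∷ All.map (∈-++⁺ʳ (arcs core)) F⊆)
      (All.++⁺ {xs = arcs core}
        (inj₁ tv ∷ inj₂ tv ∷ All.++⁺ (at-hub _ us tx) (at-hub _ ts tv))
        (All.map (⊎-map there there) dom))
      size
      where
      tv : Touches ((v , x) ∷ F) v
      tv = here (inj₁ refl)
      tx : Touches ((v , x) ∷ F) x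
      tx = here (inj₂ refl)
      size : 2 * suc (length F) + k ≤ length (verts (core ⊕ s))
      -- The new edge costs 2 in the bound, and `v` and `x` supply exactly two vertices; links carry
      -- none.
      size rewrite no-verts x us | no-verts v ts = ≤-trans (≤-reflexive two) (s≤s (s≤s bd))
        where
        open +-*-Solver using (con; _:*_; _:+_; _:=_) renaming (solve to ℕ-solve)
        two : 2 * suc (length F) + k ≡ 2 + (2 * length F + k)
        two = ℕ-solve 2 (λ f k → con 2 :* (con 1 :+ f) :+ k := con 2 :+ (con 2 :* f :+ k)) refl (length F) k

  Surplus-pt : ∀ x → Surplus (tree x nil) 1
  Surplus-pt x = surplus [] [] [] ≤-refl

  -- Greedy choice: in each component with an edge, take the edge from its root to the first child
  -- and recurse on what is left. An isolated vertex needs no edge.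
  Surplus-comps-0 : ∀ f → Surplus (comps f) 0
  Surplus-comps-0 nil = Surplus-ε
  Surplus-comps-0 (br x nil ts) =
    Surplus-≤ z≤n (Surplus-⊕ (tree x nil) (comps ts) (Surplus-pt x) (Surplus-comps-0 ts))
  Surplus-comps-0 (br x (br y us us′) ts) =
    Surplus-⊕ (tree x (br y us us′)) (comps ts)
      (Surplus-tree x y us us′ (Surplus-comps-0 us) (Surplus-comps-0 us′)) (Surplus-comps-0 ts)

  Surplus-tree-0 : ∀ x f → Surplus (tree x f) 0
  Surplus-tree-0 x f = Surplus-resp (identityʳ (tree x f)) (Surplus-comps-0 (br x f nil))

  Surplus-leaves : ∀ ys → Surplus (comps (leaves ys)) (length ys)
  Surplus-leaves []       = Surplus-ε
  Surplus-leaves (y ∷ ys) = Surplus-⊕ (tree y nil) (comps (leaves ys)) (Surplus-pt y) (Surplus-leaves ys)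

  -- Once `v` and `x` are deleted, each leaf at `x` is an isolated vertex: it needs no edge and
  -- stays uncovered.
  Surplus-broom : ∀ {v x ts} ys {e} → Surplus (comps ts) e →
                  Surplus (tree v (br x (leaves ys) ts)) (length ys + e)
  Surplus-broom ys = Surplus-tree _ _ (leaves ys) _ (Surplus-leaves ys)

  -- Spiders and components of small surplus

  leg : V → V × V → Shape
  leg v (x , y) = link v x ⊕ (pt x ⊕ (link x y ⊕ pt y))

  legs : V → List (V × V) → Shape
  legs v []       = ε
  legs v (l ∷ ls) = leg v l ⊕ legs v ls

  -- Any number of legs is allowed: none gives a single vertex, one gives a path on three vertices.
  spiderˢ : V → List (V × V) → Shape
  spiderˢ v ls = pt v ⊕ legs v ls

  hang-leg : ∀ v x y ts s → hang v ts ≈ s → hang v (br x (br y nil nil) ts) ≈ leg v (x , y) ⊕ s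
  hang-leg v x y ts s eq = begin
    link v x ⊕ ((pt x ⊕ (link x y ⊕ ((pt y ⊕ ε) ⊕ ε))) ⊕ hang v ts)
      ≈⟨ ∙-congˡ {link v x} (∙-congˡ {pt x ⊕ (link x y ⊕ ((pt y ⊕ ε) ⊕ ε))} eq) ⟩
    link v x ⊕ ((pt x ⊕ (link x y ⊕ ((pt y ⊕ ε) ⊕ ε))) ⊕ s)
      ≈⟨ solve 5 (λ l p k q s → l ⊞ ((p ⊞ (k ⊞ ((q ⊞ ∅) ⊞ ∅))) ⊞ s) ⊜ (l ⊞ (p ⊞ (k ⊞ q))) ⊞ s) ≈-refl
           (link v x) (pt x) (link x y) (pt y) s ⟩
    leg v (x , y) ⊕ s ∎

  -- A single vertex is itself uncovered and a broom leaves its tips uncovered, so a single edge is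
  -- the only exception.
  edge-or-surplus : ∀ x f → (∃ λ y → f ≡ br y nil nil) ⊎ Surplus (tree x f) 1
  edge-or-surplus x f with small-or-broom x f
  ... | inj₁ refl        = inj₂ (Surplus-pt x)
  ... | inj₂ (inj₁ edge) = inj₁ edge
  ... | inj₂ (inj₂ (broom y ys ts eq)) =
    inj₂ (Surplus-resp (≈-sym eq) (Surplus-≤ (s≤s z≤n) (Surplus-broom (y ∷ ys) (Surplus-comps-0 ts))))

  -- Surpluses of components add up, so one component that is not an edge suffices. If all are
  -- edges, each forms a leg together with its link to `v`.
  legs-or-surplus : ∀ v ts → (∃ λ ls → hang v ts ≈ legs v ls) ⊎ Surplus (comps ts) 1
  legs-or-surplus v nil = inj₁ ([] , ≈-refl)
  legs-or-surplus v (br x us ts) with edge-or-surplus x us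
  ... | inj₂ S = inj₂ (Surplus-⊕ (tree x us) (comps ts) S (Surplus-comps-0 ts))
  ... | inj₁ (y , refl) with legs-or-surplus v ts
  ...   | inj₁ (ls , eq) = inj₁ ((x , y) ∷ ls , hang-leg v x y ts (legs v ls) eq)
  ...   | inj₂ S = inj₂ (Surplus-⊕ (tree x (br y nil nil)) (comps ts) (Surplus-tree-0 x (br y nil nil)) S)

  broom-spider : ∀ v x y ts ls → hang v ts ≈ legs v ls →
                 tree v (br x (leaves (y ∷ [])) ts) ≈ spiderˢ v ((x , y) ∷ ls)
  broom-spider v x y ts ls eq = ∙-congˡ {pt v} (hang-leg v x y ts (legs v ls) eq)

  -- Two tips already give 2. One tip gives 1, and the other components at the hub give another
  -- unless all of them are edges; then the tree is a spider centred at the hub. The spider case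
  -- keeps its surplus 1, to be added to that of other components later.
  edge-spider-or-surplus : ∀ x f → (∃ λ y → f ≡ br y nil nil)
    ⊎ (Surplus (tree x f) 1 × ∃ λ q → ∃ λ ls → tree x f ≈ spiderˢ q ls) ⊎ Surplus (tree x f) 2
  edge-spider-or-surplus x f with small-or-broom x f
  ... | inj₁ refl        = inj₂ (inj₁ (Surplus-pt x , x , [] , ≈-refl))
  ... | inj₂ (inj₁ edge) = inj₁ edge
  ... | inj₂ (inj₂ (broom y ys@(_ ∷ _) ts eq)) =
    inj₂ (inj₂ (Surplus-resp (≈-sym eq) (Surplus-≤ (s≤s (s≤s z≤n)) (Surplus-broom (y ∷ ys) (Surplus-comps-0 ts)))))
  ... | inj₂ (inj₂ (broom {v} {x′} y [] ts eq)) with legs-or-surplus v ts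
  ...   | inj₁ (ls , eq′) =
    inj₂ (inj₁ (Surplus-resp (≈-sym eq) (Surplus-broom (y ∷ []) (Surplus-comps-0 ts))
               , v , (x′ , y) ∷ ls , ≈-trans eq (broom-spider v x′ y ts ls eq′)))
  ...   | inj₂ S = inj₂ (inj₂ (Surplus-resp (≈-sym eq) (Surplus-broom (y ∷ []) S)))

  -- Below surplus 2 there is room for only one component that is not an edge, and it must be a
  -- spider. Its centre `q` may differ from the vertex `z` at which `v` meets it.
  legs-spider-or-surplus : ∀ v ts → (∃ λ ls → hang v ts ≈ legs v ls)
    ⊎ (∃ λ ls → ∃ λ z → ∃ λ q → ∃ λ ms → z ∈ verts (spiderˢ q ms) × hang v ts ≈ legs v ls ⊕ (link v z ⊕ spiderˢ q ms))
    ⊎ Surplus (comps ts) 2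
  legs-spider-or-surplus v nil = inj₁ ([] , ≈-refl)
  legs-spider-or-surplus v (br x us ts) with edge-spider-or-surplus x us
  ... | inj₂ (inj₂ S) = inj₂ (inj₂ (Surplus-⊕ (tree x us) (comps ts) S (Surplus-comps-0 ts)))
  ... | inj₁ (y , refl) with legs-spider-or-surplus v ts
  ...   | inj₁ (ls , eq) = inj₁ ((x , y) ∷ ls , hang-leg v x y ts (legs v ls) eq)
  ...   | inj₂ (inj₁ (ls , z , q , ms , z∈ , eq)) = inj₂ (inj₁ ((x , y) ∷ ls , z , q , ms , z∈ ,
            ≈-trans (hang-leg v x y ts (legs v ls ⊕ (link v z ⊕ spiderˢ q ms)) eq)
              (≈-sym (CommutativeMonoid.assoc (shapes V) (leg v (x , y)) (legs v ls) (link v z ⊕ spiderˢ q ms)))))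
  ...   | inj₂ (inj₂ S) = inj₂ (inj₂ (Surplus-⊕ (tree x (br y nil nil)) (comps ts) (Surplus-tree-0 x (br y nil nil)) S))
  legs-spider-or-surplus v (br x us ts) | inj₂ (inj₁ (S , q , ms , eq)) with legs-or-surplus v ts
  ...   | inj₂ S′ = inj₂ (inj₂ (Surplus-⊕ (tree x us) (comps ts) S S′))
  -- `v` meets the component at its old root `x`, which may be any vertex of the spider.
  ...   | inj₁ (ls , eq′) = inj₂ (inj₁ (ls , x , q , ms , ∈-resp-↭ (proj₁ eq) (here refl) , (begin
      link v x ⊕ (tree x us ⊕ hang v ts)         ≈⟨ ∙-congˡ {link v x} (⊕-cong eq eq′) ⟩
      link v x ⊕ (spiderˢ q ms ⊕ legs v ls)      ≈⟨ solve 3 (λ l s t → l ⊞ (s ⊞ t) ⊜ t ⊞ (l ⊞ s)) ≈-refl (link v x) (spiderˢ q ms) (legs v ls) ⟩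
      legs v ls ⊕ (link v x ⊕ spiderˢ q ms)      ∎)))

  -- Classification of trees without surplus 3

  -- Only `is-spider` has odd order. In the families the legs `l` and `m`, listed apart, will be the
  -- two ends of the named path. In `spider+leaf-at-joint` the list `ls` may be empty, which gives
  -- the star on four vertices.
  data Class (s : Shape) : Set where
    is-spider : ∀ v ls → s ≈ spiderˢ v ls → Class s
    spider+leaf-at-centre : ∀ v l ls q → s ≈ spiderˢ v (l ∷ ls) ⊕ (link v q ⊕ pt q) → Class s
    in-familyA : ∀ v l ls q m ms → s ≈ spiderˢ v (l ∷ ls) ⊕ (link v q ⊕ spiderˢ q (m ∷ ms)) → Class s
    spider+leaf-at-joint : ∀ v ls u w q → s ≈ spiderˢ v ls ⊕ ((link v u ⊕ (pt u ⊕ (link u w ⊕ pt w))) ⊕ (link u q ⊕ pt q)) → Class s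
    in-familyB : ∀ v l ls u w q m ms →
      s ≈ spiderˢ v (l ∷ ls) ⊕ ((link v u ⊕ (pt u ⊕ (link u w ⊕ pt w))) ⊕ (link u q ⊕ spiderˢ q (m ∷ ms))) → Class s
    in-familyC : ∀ v l ls a b q m ms →
      s ≈ spiderˢ v (l ∷ ls) ⊕ ((link v a ⊕ (pt a ⊕ (link a b ⊕ pt b))) ⊕ (link b q ⊕ spiderˢ q (m ∷ ms))) → Class s

  data LegSplit (z q : V) (ms : List (V × V)) : Set where
    at-joint : ∀ y ms′ → legs q ms ≈ leg q (z , y) ⊕ legs q ms′ → LegSplit z q ms
    at-tip   : ∀ x ms′ → legs q ms ≈ leg q (x , z) ⊕ legs q ms′ → LegSplit z q ms

  leg-split : ∀ {z} q ms → z ∈ verts (legs q ms) → LegSplit z q ms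
  leg-split q ((x , y) ∷ ms) (here refl)         = at-joint y ms ≈-refl
  leg-split q ((x , y) ∷ ms) (there (here refl)) = at-tip x ms ≈-refl
  leg-split {z} q (l ∷ ms) (there (there z∈)) with leg-split q ms z∈
  ... | at-joint y ms′ eq = at-joint y (l ∷ ms′) (begin
    leg q l ⊕ legs q ms                      ≈⟨ ∙-congˡ {leg q l} eq ⟩
    leg q l ⊕ (leg q (z , y) ⊕ legs q ms′)   ≈⟨ solve 3 (λ a b c → a ⊞ (b ⊞ c) ⊜ b ⊞ (a ⊞ c)) ≈-refl (leg q l) (leg q (z , y)) (legs q ms′) ⟩
    leg q (z , y) ⊕ (leg q l ⊕ legs q ms′)   ∎)
  ... | at-tip x ms′ eq = at-tip x (l ∷ ms′) (begin
    leg q l ⊕ legs q ms                      ≈⟨ ∙-congˡ {leg q l} eq ⟩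
    leg q l ⊕ (leg q (x , z) ⊕ legs q ms′)   ≈⟨ solve 3 (λ a b c → a ⊞ (b ⊞ c) ⊜ b ⊞ (a ⊞ c)) ≈-refl (leg q l) (leg q (x , z)) (legs q ms′) ⟩
    leg q (x , z) ⊕ (leg q l ⊕ legs q ms′)   ∎)

  -- The position of `z` in the second spider decides: centre, joint and tip lead to families A, B
  -- and C. When the second spider has no leg beyond the one containing `z`, or none at all, the
  -- tree falls into a simpler class.
  joined-spiders : ∀ {s} v l ls z q ms → z ∈ verts (spiderˢ q ms) →
    s ≈ spiderˢ v (l ∷ ls) ⊕ (link v z ⊕ spiderˢ q ms) → Class s
  joined-spiders v l ls z q []       (here refl) eq = spider+leaf-at-centre v l ls q eq
  joined-spiders v l ls z q (m ∷ ms) (here refl) eq = in-familyA v l ls q m ms eq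
  joined-spiders {s} v l ls z q ms (there z∈) eq with leg-split q ms z∈
  ... | at-joint y ms′ eq′ = finish ms′ (begin
    s  ≈⟨ eq ⟩
    spiderˢ v (l ∷ ls) ⊕ (link v z ⊕ (pt q ⊕ legs q ms))
       ≈⟨ ∙-congˡ {spiderˢ v (l ∷ ls)} (∙-congˡ {link v z} (∙-congˡ {pt q} eq′)) ⟩
    spiderˢ v (l ∷ ls) ⊕ (link v z ⊕ (pt q ⊕ ((link q z ⊕ (pt z ⊕ (link z y ⊕ pt y))) ⊕ legs q ms′)))
       -- Links are atoms for the solver, so the link between `q` and `z` is first turned to point
       -- away from `v`.
       ≈⟨ ∙-congˡ {spiderˢ v (l ∷ ls)} (∙-congˡ {link v z} (∙-congˡ {pt q} (∙-congʳ {legs q ms′} (∙-congʳ {pt z ⊕ (link z y ⊕ pt y)} (link-sym q z))))) ⟩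
    spiderˢ v (l ∷ ls) ⊕ (link v z ⊕ (pt q ⊕ ((link z q ⊕ (pt z ⊕ (link z y ⊕ pt y))) ⊕ legs q ms′)))
       ≈⟨ ∙-congˡ {spiderˢ v (l ∷ ls)} (solve 7 (λ l c k p j y m → l ⊞ (c ⊞ ((k ⊞ (p ⊞ (j ⊞ y))) ⊞ m)) ⊜ (l ⊞ (p ⊞ (j ⊞ y))) ⊞ (k ⊞ (c ⊞ m))) ≈-refl
            (link v z) (pt q) (link z q) (pt z) (link z y) (pt y) (legs q ms′)) ⟩
    spiderˢ v (l ∷ ls) ⊕ ((link v z ⊕ (pt z ⊕ (link z y ⊕ pt y))) ⊕ (link z q ⊕ spiderˢ q ms′)) ∎)
    where
    finish : ∀ ms′ → s ≈ spiderˢ v (l ∷ ls) ⊕ ((link v z ⊕ (pt z ⊕ (link z y ⊕ pt y))) ⊕ (link z q ⊕ spiderˢ q ms′)) → Class s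
    -- Without further legs `q` is a second leaf at `z`, next to `y`.
    finish []         eq = spider+leaf-at-joint v (l ∷ ls) z y q eq
    finish (m ∷ ms′)  eq = in-familyB v l ls z y q m ms′ eq
  ... | at-tip x ms′ eq′ = finish ms′ (begin
    s  ≈⟨ eq ⟩
    spiderˢ v (l ∷ ls) ⊕ (link v z ⊕ (pt q ⊕ legs q ms))
       ≈⟨ ∙-congˡ {spiderˢ v (l ∷ ls)} (∙-congˡ {link v z} (∙-congˡ {pt q} eq′)) ⟩
    spiderˢ v (l ∷ ls) ⊕ (link v z ⊕ (pt q ⊕ ((link q x ⊕ (pt x ⊕ (link x z ⊕ pt z))) ⊕ legs q ms′)))
       ≈⟨ ∙-congˡ {spiderˢ v (l ∷ ls)} (∙-congˡ {link v z} (∙-congˡ {pt q} (∙-congʳ {legs q ms′}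
            (⊕-cong (link-sym q x) (∙-congˡ {pt x} (∙-congʳ {pt z} (link-sym x z))))))) ⟩
    spiderˢ v (l ∷ ls) ⊕ (link v z ⊕ (pt q ⊕ ((link x q ⊕ (pt x ⊕ (link z x ⊕ pt z))) ⊕ legs q ms′)))
       ≈⟨ ∙-congˡ {spiderˢ v (l ∷ ls)} (solve 7 (λ l c k p j y m → l ⊞ (c ⊞ ((k ⊞ (p ⊞ (j ⊞ y))) ⊞ m)) ⊜ (l ⊞ (y ⊞ (j ⊞ p))) ⊞ (k ⊞ (c ⊞ m))) ≈-refl
            (link v z) (pt q) (link x q) (pt x) (link z x) (pt z) (legs q ms′)) ⟩
    spiderˢ v (l ∷ ls) ⊕ ((link v z ⊕ (pt z ⊕ (link z x ⊕ pt x))) ⊕ (link x q ⊕ spiderˢ q ms′)) ∎)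
    where
    finish : ∀ ms′ → s ≈ spiderˢ v (l ∷ ls) ⊕ ((link v z ⊕ (pt z ⊕ (link z x ⊕ pt x))) ⊕ (link x q ⊕ spiderˢ q ms′)) → Class s
    -- Here z is itself a second centre, with the single leg x q.
    finish []         eq = in-familyA v l ls z (x , q) [] (≈-trans eq (∙-congˡ {spiderˢ v (l ∷ ls)}
      (solve 6 (λ l a k b j q → (l ⊞ (a ⊞ (k ⊞ b))) ⊞ (j ⊞ (q ⊞ ∅)) ⊜ l ⊞ (a ⊞ ((k ⊞ (b ⊞ (j ⊞ q))) ⊞ ∅))) ≈-refl
         (link v z) (pt z) (link z x) (pt x) (link x q) (pt q))))
    finish (m ∷ ms′)  eq = in-familyC v l ls z x q m ms′ eq

  -- The surplus 3 is shared between the tips and the rest: three tips suffice, two tips leave 1 and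
  -- one tip leaves 2 for the components at the hub.
  classify : ∀ x f → 3 ≤ length (verts (tree x f)) → Class (tree x f) ⊎ Surplus (tree x f) 3
  classify x f 3≤ with small-or-broom x f
  ... | inj₁ refl = contradiction 3≤ λ { (s≤s ()) }
  ... | inj₂ (inj₁ (_ , refl)) = contradiction 3≤ λ { (s≤s (s≤s ())) }
  ... | inj₂ (inj₂ (broom y ys@(_ ∷ _ ∷ _) ts eq)) =
    inj₂ (Surplus-resp (≈-sym eq) (Surplus-≤ (s≤s (s≤s (s≤s z≤n))) (Surplus-broom (y ∷ ys) (Surplus-comps-0 ts))))
  ... | inj₂ (inj₂ (broom {v} {x′} y (y′ ∷ []) ts eq)) with legs-or-surplus v ts
  ...   | inj₂ S = inj₂ (Surplus-resp (≈-sym eq) (Surplus-broom (y ∷ y′ ∷ []) S))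
  ...   | inj₁ (ls , eq′) = inj₁ (spider+leaf-at-joint v ls x′ y y′ (begin
    tree x f ≈⟨ eq ⟩
    pt v ⊕ (link v x′ ⊕ ((pt x′ ⊕ (link x′ y ⊕ ((pt y ⊕ ε) ⊕ (link x′ y′ ⊕ ((pt y′ ⊕ ε) ⊕ ε))))) ⊕ hang v ts))
      ≈⟨ ∙-congˡ {pt v} (∙-congˡ {link v x′} (∙-congˡ {pt x′ ⊕ (link x′ y ⊕ ((pt y ⊕ ε) ⊕ (link x′ y′ ⊕ ((pt y′ ⊕ ε) ⊕ ε))))} eq′)) ⟩
    pt v ⊕ (link v x′ ⊕ ((pt x′ ⊕ (link x′ y ⊕ ((pt y ⊕ ε) ⊕ (link x′ y′ ⊕ ((pt y′ ⊕ ε) ⊕ ε))))) ⊕ legs v ls))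
      ≈⟨ solve 8 (λ v k x l y m z ls → v ⊞ (k ⊞ ((x ⊞ (l ⊞ ((y ⊞ ∅) ⊞ (m ⊞ ((z ⊞ ∅) ⊞ ∅))))) ⊞ ls))
              ⊜ (v ⊞ ls) ⊞ ((k ⊞ (x ⊞ (l ⊞ y))) ⊞ (m ⊞ z))) ≈-refl
           (pt v) (link v x′) (pt x′) (link x′ y) (pt y) (link x′ y′) (pt y′) (legs v ls) ⟩
    spiderˢ v ls ⊕ ((link v x′ ⊕ (pt x′ ⊕ (link x′ y ⊕ pt y))) ⊕ (link x′ y′ ⊕ pt y′)) ∎))
  classify x f 3≤ | inj₂ (inj₂ (broom {v} {x′} y [] ts eq)) with legs-spider-or-surplus v ts
  ...   | inj₂ (inj₂ S) = inj₂ (Surplus-resp (≈-sym eq) (Surplus-broom (y ∷ []) S))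
  ...   | inj₁ (ls , eq′) = inj₁ (is-spider v ((x′ , y) ∷ ls) (≈-trans eq (broom-spider v x′ y ts ls eq′)))
  ...   | inj₂ (inj₁ (ls , z , q , ms , z∈ , eq′)) = inj₁ (joined-spiders v (x′ , y) ls z q ms z∈ (begin
    tree x f ≈⟨ eq ⟩
    tree v (br x′ (leaves (y ∷ [])) ts)
      ≈⟨ ∙-congˡ {pt v} (hang-leg v x′ y ts (legs v ls ⊕ (link v z ⊕ spiderˢ q ms)) eq′) ⟩
    pt v ⊕ (leg v (x′ , y) ⊕ (legs v ls ⊕ (link v z ⊕ spiderˢ q ms)))
      ≈⟨ solve 4 (λ p l ls r → p ⊞ (l ⊞ (ls ⊞ r)) ⊜ (p ⊞ (l ⊞ ls)) ⊞ r) ≈-refl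
           (pt v) (leg v (x′ , y)) (legs v ls) (link v z ⊕ spiderˢ q ms) ⟩
    spiderˢ v ((x′ , y) ∷ ls) ⊕ (link v z ⊕ spiderˢ q ms) ∎))

-- From graphs to shapes

Unique-resp-↭ : ∀ {A : Set} {xs ys : List A} → xs ↭ ys → Unique xs → Unique ys
Unique-resp-↭ {A} p = PermutationSetoid.Unique-resp-↭ (≡-setoid A) (↭⇒↭ₛ p)

Unique-resp-⊑ : ∀ {A : Set} {xs ys : List A} → xs ⊑ ys → Unique ys → Unique xs
Unique-resp-⊑ []         []        = []
Unique-resp-⊑ (_ ∷ʳ p)   (_ ∷ us)  = Unique-resp-⊑ p us
Unique-resp-⊑ (refl ∷ p) (u ∷ us)  = All-resp-⊆ p u ∷ Unique-resp-⊑ p us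

-- The embedding ι is the identity for T itself and punchIn w for the graph T - w.
record Presents {m} {V : Set} (G : Graph m) (ι : Fin m → V) (s : Shape) : Set where
  field
    injective : ∀ {a b} → ι a ≡ ι b → a ≡ b
    unique    : Unique (verts s)
    covered   : ∀ a → ι a ∈ verts s
    onto      : ∀ {v} → v ∈ verts s → ∃ λ a → ι a ≡ v
    adj⇒arc   : ∀ {a b} → Adj G a b → (ι a , ι b) ∈ arcs s
    arc⇒adj   : ∀ {a b} → (ι a , ι b) ∈ arcs s → Adj G a b

Presents-resp : ∀ {m V} {G : Graph m} {ι : Fin m → V} {s t} → s ≈ t → Presents G ι s → Presents G ι t
Presents-resp (vs , as) P = record
  { injective = injective
  ; unique    = Unique-resp-↭ vs unique
  ; covered   = ∈-resp-↭ vs ∘ covered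
  ; onto      = onto ∘ ∈-resp-↭ (↭-sym vs)
  ; adj⇒arc   = ∈-resp-↭ as ∘ adj⇒arc
  ; arc⇒adj   = arc⇒adj ∘ ∈-resp-↭ (↭-sym as)
  }
  where open Presents P

AdjPair : ∀ {n} → Graph n → Fin n × Fin n → Set
AdjPair G (a , b) = Adj G a b

module _ {n} {G : Graph n} where

  adj-sym : IsSimple G → ∀ {u v} → Adj G u v → Adj G v u
  adj-sym (G-sym , _) {u} {v} = subst IsTrue (G-sym u v)

  no-loop : IsSimple G → ∀ {u} → ¬ Adj G u u
  no-loop (_ , irrefl) {u} = subst IsTrue (irrefl u)

  -- Only one inclusion is recorded: arcs are edges of `G`. The converse for a spanning subtree
  -- comes from acyclicity in `tree-presentation`.
  record Subtree : Set where
    constructor subtree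
    field
      root   : Fin n
      forest : Forest
      unique : Unique (verts (tree root forest))
      edges  : All (AdjPair G) (arcs (tree root forest))
    vertices : List (Fin n)
    vertices = verts (tree root forest)
  open Subtree

  _≼_ : Subtree → Subtree → Set
  s ≼ t = ∀ {v} → v ∈ vertices s → v ∈ vertices t

  _∈?_ : ∀ (w : Fin n) vs → Dec (w ∈ vs)
  w ∈? vs = any? (w ≟ᶠ_) vs

  -- Rerooting at `u` lets the new vertex be attached as a first child of the root.
  add-leaf : IsSimple G → ∀ {u w} t → u ∈ vertices t → Adj G u w →
             ∃ λ t′ → t ≼ t′ × w ∈ vertices t′
  add-leaf simple {u} {w} t u∈ uw with w ∈? vertices t
  ... | yes w∈ = t , (λ z → z) , w∈
  ... | no w∉ with reroot (root t) (forest t) u∈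
  ...   | g , eq@(vs , as) = subtree u (br w nil g)
            (Unique-resp-↭ (swap w u ↭-refl)
              (All.tabulate (λ { z∈ refl → w∉ (∈-resp-↭ (↭-sym vs) z∈) }) ∷ Unique-resp-↭ vs (unique t)))
            (uw ∷ adj-sym simple uw ∷ All-resp-↭ as (edges t))
          , (λ z∈ → insert (∈-resp-↭ vs z∈)) , there (here refl)
    where
    insert : ∀ {z} → z ∈ verts (tree u g) → z ∈ verts (tree u (br w nil g))
    insert (here p)  = here p
    insert (there p) = there (there p)

  add-walk : IsSimple G → ∀ {u w k} t → u ∈ vertices t → Walk G u w k →
             ∃ λ t′ → t ≼ t′ × w ∈ vertices t′
  add-walk simple t u∈ nil = t , (λ z → z) , u∈
  add-walk simple t u∈ (cons uv vw) with add-leaf simple t u∈ uv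
  ... | t₁ , t≼t₁ , v∈ with add-walk simple t₁ v∈ vw
  ...   | t₂ , t₁≼t₂ , w∈ = t₂ , t₁≼t₂ ∘ t≼t₁ , w∈

  spanning-subtree : IsTree G → Fin n → ∃ λ t → ∀ w → w ∈ vertices t
  spanning-subtree (simple , connected , _) r with go (allFin n)
    where
    go : ∀ ws → ∃ λ t → r ∈ vertices t × All (_∈ vertices t) ws
    go [] = subtree r nil ([] ∷ []) [] , here refl , []
    go (w ∷ ws) with go ws
    ... | t , r∈ , ws∈ with add-walk simple t r∈ (proj₂ (connected r w))
    ...   | t′ , t≼t′ , w∈ = t′ , t≼t′ r∈ , w∈ ∷ All.map t≼t′ ws∈
  ... | t , _ , all∈ = t , λ w → All.lookup all∈ (∈-allFin w)

  -- `inner` lists the path after `v` and ends with `b`. `linked` extends it by a neighbour `c` of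
  -- `b`; with `c` equal to `v` this is the closed list required by `IsCycle`. The sublist relation
  -- transfers distinctness of vertices to the path.
  record Path (v b : Fin n) (f : Forest) : Set where
    field
      inner   : List (Fin n)
      inner⊑  : inner ⊑ verts (hang v f)
      direct  : (v , b) ∈ arcs (hang v f) ⊎ 2 ≤ length inner
      nonempty : 1 ≤ length inner
      linked  : ∀ {c} → Adj G b c → Linked (Adj G) (v ∷ inner ++ c ∷ [])

  path : ∀ v f {b} → All (AdjPair G) (arcs (hang v f)) → b ∈ verts (hang v f) → Path v b f
  path v (br x us ts) (vx ∷ _ ∷ _) (here refl) = record
    { inner = x ∷ [] ; inner⊑ = refl ∷ minimum _ ; direct = inj₁ (here refl) ; nonempty = s≤s z≤n ; linked = λ bc → vx ∷ bc ∷ [-] }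
  path v (br x us ts) (vx ∷ _ ∷ adj) (there b∈) with ∈-++⁻ (verts (hang x us)) b∈
  ... | inj₁ b∈us = record
    { inner = x ∷ inner ; inner⊑ = refl ∷ ++⁺ʳ _ inner⊑ ; direct = inj₂ (s≤s nonempty) ; nonempty = s≤s z≤n
    ; linked = λ bc → vx ∷ linked bc }
    where
    open Path (path x us (All.++⁻ˡ _ adj) b∈us)
  ... | inj₂ b∈ts = record
    { inner = inner ; inner⊑ = x ∷ʳ ++⁺ˡ _ inner⊑ ; direct = ⊎-map₁ (there ∘ there ∘ ∈-++⁺ʳ _) direct
    ; nonempty = nonempty ; linked = linked }
    where open Path (path v ts (All.++⁻ʳ (arcs (hang x us)) adj) b∈ts)


  -- An edge of `G` outside the spanning subtree would close the tree path between its ends into a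
  -- cycle.
  tree-presentation : IsTree G → Fin n → ∃ λ v → ∃ λ f → Presents G (λ a → a) (tree v f)
  tree-presentation isTree@(simple , _ , acyclic) r with spanning-subtree isTree r
  ... | t , all∈ = root t , forest t , record
    { injective = λ eq → eq
    ; unique    = unique t
    ; covered   = all∈
    ; onto      = λ {v} _ → v , refl
    ; adj⇒arc   = arc
    ; arc⇒adj   = All.lookup (edges t)
    }
    where
    arc : ∀ {a b} → Adj G a b → (a , b) ∈ arcs (tree (root t) (forest t))
    arc {a} {b} ab with reroot (root t) (forest t) (all∈ a)
    ... | g , (vs , as) with ∈-resp-↭ vs (all∈ b)
    ...   | here refl = ⊥-elim (no-loop simple ab)
    ...   | there b∈ with path a g (All-resp-↭ as (edges t)) b∈
    ...     | p with Path.direct p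
    ...       | inj₁ ab∈ = ∈-resp-↭ (↭-sym as) ab∈
    ...       | inj₂ 2≤  = ⊥-elim (acyclic a (Path.inner p)
      (2≤ , Unique-resp-⊑ (refl ∷ Path.inner⊑ p) (Unique-resp-↭ vs (unique t)) , Path.linked p (adj-sym simple ab)))

  order : ∀ {s} → Presents G (λ a → a) s → length (verts s) ≡ n
  order {s} P = trans (↭-length (∼bag⇒↭ {x = verts s} {y = allFin n} (unique∧set⇒bag (Presents.unique P) (allFin⁺ n)
    (λ {v} → mk⇔ (λ _ → ∈-allFin v) (λ _ → Presents.covered P v))))) (length-tabulate {n = n} (λ a → a))

  -- From dominating edges to isolating sets of the middle graph

  edge-≡ : ∀ {e f : Edge G} → proj₁ e ≡ proj₁ f → e ≡ f
  edge-≡ {(p , a , b)} {(.p , c , d)} refl = cong₂ (λ x y → p , x , y) (<-irrelevant a c) (T-irrelevant b d)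

  _≟ᵉ_ : (e f : Edge G) → Dec (e ≡ f)
  e ≟ᵉ f with Product.≡-dec _≟ᶠ_ _≟ᶠ_ (proj₁ e) (proj₁ f)
  ... | yes eq = yes (edge-≡ eq)
  ... | no neq = no (neq ∘ cong proj₁)

  orient : IsSimple G → ∀ {a b} → Adj G a b → ∃ λ e → ∀ {v} → v ≡ a ⊎ v ≡ b → IsEnd {G = G} v e
  orient simple {a} {b} ab with <ᶠ-cmp a b
  ... | tri< a<b _ _ = ((a , b) , a<b , ab) , λ v → v
  ... | tri≈ _ refl _ = ⊥-elim (no-loop simple ab)
  ... | tri> _ _ b<a = ((b , a) , b<a , adj-sym simple ab) , λ { (inj₁ p) → inj₂ p ; (inj₂ p) → inj₁ p }

  orient-all : IsSimple G → ∀ {F} → All (AdjPair G) F →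
    ∃ λ (S : List (MidV G)) → length S ≡ length F × (∀ {v} → Touches F v → ∃ λ e → inj₂ e ∈ S × IsEnd {G = G} v e)
  orient-all simple [] = [] , refl , λ ()
  orient-all simple (ab ∷ adj) with orient simple ab | orient-all simple adj
  ... | e , ends | S , len , touch = inj₂ e ∷ S , cong suc len , λ
    { (here p)  → e , here refl , ends p
    ; (there p) → let (f , f∈ , end) = touch p in f , there f∈ , end }

  -- Every vertex m_e lies in the closed neighbourhood: an end of e is touched by `F`, hence shared
  -- with an edge in `S`. What may remain are vertices of `G`, which are pairwise nonadjacent in the
  -- middle graph.
  isolating : ∀ {F} S → (∀ {v} → Touches F v → ∃ λ e → inj₂ e ∈ S × IsEnd {G = G} v e) →
              (∀ {a b} → Adj G a b → Dominates F (a , b)) → IsIsolating (MidAdj G) S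
  isolating {F} S touch dom = iso
    where
    -- Double negation suffices for `IsIsolating`, and the refutation `¬N` itself supplies the
    -- distinctness of the two edges that `MidAdj` demands.
    covered : ∀ e → ¬ ¬ ClosedNbhd (MidAdj G) S (inj₂ e)
    covered e@((a , b) , _ , ab) ¬N = case (dom ab)
      where
      meet : ∀ {v} → Touches F v → IsEnd {G = G} v e → ClosedNbhd (MidAdj G) S (inj₂ e)
      meet t end = let (f , f∈ , end′) = touch t in
        inj₂ (inj₂ f , f∈ , (λ { refl → ¬N (inj₁ f∈) }) , _ , end′ , end)
      case : ¬ Dominates F (a , b)
      case (inj₁ t) = ¬N (meet t (inj₁ refl))
      case (inj₂ t) = ¬N (meet t (inj₂ refl))
    iso : IsIsolating (MidAdj G) S
    iso (inj₁ _) (inj₁ _) _ _ ()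
    iso (inj₂ e) _ ¬N _ _ = covered e ¬N
    iso (inj₁ _) (inj₂ e) _ ¬N _ = covered e ¬N

  -- From 2|F| + 3 ≤ n it follows that |F| + 1 ≤ (n - 1)/2, so the isolating set obtained from `F`
  -- is smaller than the minimum.
  no-surplus : IsSimple G → ∀ {s} → Presents G (λ a → a) s →
    (∀ S → Unique S → IsIsolating (MidAdj G) S → (n ∸ 1) / 2 ≤ length S) → ¬ Surplus s 3
  no-surplus simple {s} P least (surplus F F⊆ dom bd) with orient-all simple (All.map (Presents.arc⇒adj P) F⊆)
  ... | S , len , touch = <⇒≱ small (least S′ (deduplicate-! _≟ₘ_ S)
      (isolating S′ (λ t → let (e , e∈ , end) = touch t in e , ∈-deduplicate⁺ _≟ₘ_ e∈ , end)
        (λ ab → All.lookup dom (Presents.adj⇒arc P ab))))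
    where
    _≟ₘ_ = ≡-dec _≟ᶠ_ _≟ᵉ_
    -- Minimality concerns duplicate-free lists, while `F` may repeat an edge, possibly in both
    -- orientations.
    S′ = deduplicate _≟ₘ_ S
    S′≤F : length S′ ≤ length F
    S′≤F = ≤-trans (length-deduplicate _≟ₘ_ S) (≤-reflexive len)
    small : length S′ < (n ∸ 1) / 2
    small = begin
      suc (length S′)            ≤⟨ s≤s S′≤F ⟩
      suc (length F)             ≡⟨ m*n/n≡m (suc (length F)) 2 ⟨
      suc (length F) * 2 / 2     ≤⟨ /-monoˡ-≤ 2 (∸-monoˡ-≤ 1 size) ⟩
      (n ∸ 1) / 2                ∎
      where
      open ≤-Reasoning
      open +-*-Solver using (con; _:*_; _:+_; _:=_) renaming (solve to ℕ-solve)
      size : suc (suc (length F) * 2) ≤ n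
      size = begin
        suc (suc (length F) * 2)   ≡⟨ ℕ-solve 1 (λ f → con 1 :+ (con 1 :+ f) :* con 2 := con 2 :* f :+ con 3) refl (length F) ⟩
        2 * length F + 3           ≤⟨ bd ⟩
        length (verts s)           ≡⟨ order P ⟩
        n                          ∎

-- From shapes to the labelled graphs edgeGraph

T-ext : ∀ {x y} → (IsTrue x → IsTrue y) → (IsTrue y → IsTrue x) → x ≡ y
T-ext {true}  {true}  _ _ = refl
T-ext {false} {false} _ _ = refl
T-ext {true}  {false} f _ = ⊥-elim (f _)
T-ext {false} {true}  _ g = ⊥-elim (g _)

-- The test inside `edgeGraph`, written so that both unfold to the same term.
joins : ℕ → ℕ → ℕ × ℕ → Bool
joins a b e = ((proj₁ e ≡ᵇ a) ∧ (proj₂ e ≡ᵇ b)) ∨ ((proj₁ e ≡ᵇ b) ∧ (proj₂ e ≡ᵇ a))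

Joins : ℕ → ℕ → ℕ × ℕ → Set
Joins a b (i , j) = (i ≡ a × j ≡ b) ⊎ (i ≡ b × j ≡ a)

joins⁺ : ∀ {a b} e → Joins a b e → IsTrue (joins a b e)
joins⁺ (i , j) p = Equivalence.from T-∨ (⊎-map both both p)
  where
  both : ∀ {k l} → i ≡ k × j ≡ l → IsTrue ((i ≡ᵇ k) ∧ (j ≡ᵇ l))
  both {k} {l} (p , q) = Equivalence.from T-∧ (≡⇒≡ᵇ i k p , ≡⇒≡ᵇ j l q)

joins⁻ : ∀ {a b} e → IsTrue (joins a b e) → Joins a b e
joins⁻ (i , j) t = ⊎-map both both (Equivalence.to T-∨ t)
  where
  both : ∀ {k l} → IsTrue ((i ≡ᵇ k) ∧ (j ≡ᵇ l)) → i ≡ k × j ≡ l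
  both {k} {l} t = let (p , q) = Equivalence.to T-∧ t in ≡ᵇ⇒≡ i k p , ≡ᵇ⇒≡ j l q

module _ {V : Set} where

  -- Positions are natural numbers because the edge lists given to `edgeGraph` use numbers as
  -- labels.
  data At : List V → ℕ → V → Set where
    here  : ∀ {a xs} → At (a ∷ xs) 0 a
    there : ∀ {a x xs i} → At xs i a → At (x ∷ xs) (suc i) a

  At-functional : ∀ {xs i a b} → At xs i a → At xs i b → a ≡ b
  At-functional here      here      = refl
  At-functional (there p) (there q) = At-functional p q

  At⇒∈ : ∀ {xs i a} → At xs i a → a ∈ xs
  At⇒∈ here      = here refl
  At⇒∈ (there p) = there (At⇒∈ p)

  ∈⇒At : ∀ {xs a} → a ∈ xs → ∃ λ i → At xs i a
  ∈⇒At (here refl) = 0 , here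
  ∈⇒At (there a∈)  = let (i , p) = ∈⇒At a∈ in suc i , there p

  At-injective : ∀ {xs i j a} → Unique xs → At xs i a → At xs j a → i ≡ j
  At-injective u        here      here      = refl
  At-injective u        here      (there q) = contradiction (At⇒∈ q) (Unique[x∷xs]⇒x∉xs u)
  At-injective u        (there p) here      = contradiction (At⇒∈ p) (Unique[x∷xs]⇒x∉xs u)
  At-injective (_ ∷ u)  (there p) (there q) = cong suc (At-injective u p q)

  At⇒< : ∀ {xs i a} → At xs i a → i < length xs
  At⇒< here      = s≤s z≤n
  At⇒< (there p) = s≤s (At⇒< p)

  <⇒At : ∀ xs {i} → i < length xs → ∃ λ a → At xs i a
  <⇒At (x ∷ xs) {zero}  _         = x , here
  <⇒At (x ∷ xs) {suc i} (s≤s i<) = let (a , p) = <⇒At xs i< in a , there p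

  At-++ˡ : ∀ {xs ys i a} → At xs i a → At (xs ++ ys) i a
  At-++ˡ here      = here
  At-++ˡ (there p) = there (At-++ˡ p)

  At-++ʳ : ∀ xs {ys i a} → At ys i a → At (xs ++ ys) (length xs + i) a
  At-++ʳ []       p = p
  At-++ʳ (x ∷ xs) p = there (At-++ʳ xs p)

  At-map-lookup : ∀ {A : Set} (f : A → V) L i → At (map f L) (toℕ i) (f (lookup L i))
  At-map-lookup f (l ∷ L) Fin.zero    = here
  At-map-lookup f (l ∷ L) (Fin.suc i) = there (At-map-lookup f L i)

  -- `back` serves edges whose label pair and vertex pair run in opposite directions.
  data Labels (xs : List V) : ℕ × ℕ → V × V → Set where
    forth : ∀ {i j a b} → At xs i a → At xs j b → Labels xs (i , j) (a , b)
    back  : ∀ {i j a b} → At xs i b → At xs j a → Labels xs (i , j) (a , b)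

  Labels-++ : ∀ {xs ys} {k e} → Labels xs k e → Labels (xs ++ ys) k e
  Labels-++ (forth p q) = forth (At-++ˡ p) (At-++ˡ q)
  Labels-++ (back p q)  = back (At-++ˡ p) (At-++ˡ q)

  pts : List V → Shape
  pts xs = xs , []

  edgesˢ : List (V × V) → Shape
  edgesˢ []             = ε
  edgesˢ ((a , b) ∷ es) = link a b ⊕ edgesˢ es

  edges-no-verts : ∀ es → verts (edgesˢ es) ≡ []
  edges-no-verts []       = refl
  edges-no-verts (_ ∷ es) = edges-no-verts es

  module _ {xs : List V} (unique : Unique xs) {N} {a b : Fin N} {α β : V}
           (a↦α : At xs (toℕ a) α) (b↦β : At xs (toℕ b) β) where

    label-arc : ∀ {i j c d} → Labels xs (i , j) (c , d) →
                Joins (toℕ a) (toℕ b) (i , j) → (α , β) ∈ arcs (link c d)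
    label-arc (forth p q) (inj₁ (refl , refl)) = here (cong₂ _,_ (At-functional a↦α p) (At-functional b↦β q))
    label-arc (forth p q) (inj₂ (refl , refl)) = there (here (cong₂ _,_ (At-functional a↦α q) (At-functional b↦β p)))
    label-arc (back p q)  (inj₁ (refl , refl)) = there (here (cong₂ _,_ (At-functional a↦α p) (At-functional b↦β q)))
    label-arc (back p q)  (inj₂ (refl , refl)) = here (cong₂ _,_ (At-functional a↦α q) (At-functional b↦β p))

    arc-label : ∀ {i j c d} → Labels xs (i , j) (c , d) → (α , β) ∈ arcs (link c d) →
                Joins (toℕ a) (toℕ b) (i , j)
    arc-label (forth p q) (here refl)         = inj₁ (At-injective unique p a↦α , At-injective unique q b↦β)
    arc-label (forth p q) (there (here refl)) = inj₂ (At-injective unique p b↦β , At-injective unique q a↦α)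
    arc-label (back p q)  (here refl)         = inj₂ (At-injective unique p b↦β , At-injective unique q a↦α)
    arc-label (back p q)  (there (here refl)) = inj₁ (At-injective unique p a↦α , At-injective unique q b↦β)

    edgeGraph⇒arc : ∀ {ks es} → Pointwise (Labels xs) ks es → IsTrue (edgeGraph N ks a b) → (α , β) ∈ arcs (edgesˢ es)
    edgeGraph⇒arc (_∷_ {x = k} {y = e} l ls) t with Equivalence.to (T-∨ {joins (toℕ a) (toℕ b) k}) t
    ... | inj₁ t′ = ∈-++⁺ˡ (label-arc l (joins⁻ k t′))
    ... | inj₂ t′ = ∈-++⁺ʳ (arcs (link _ _)) (edgeGraph⇒arc ls t′)

    arc⇒edgeGraph : ∀ {ks es} → Pointwise (Labels xs) ks es → (α , β) ∈ arcs (edgesˢ es) → IsTrue (edgeGraph N ks a b)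
    arc⇒edgeGraph (_∷_ {x = k} {y = e} l ls) αβ∈ with ∈-++⁻ (arcs (link (proj₁ e) (proj₂ e))) αβ∈
    ... | inj₁ p = Equivalence.from (T-∨ {joins (toℕ a) (toℕ b) k}) (inj₁ (joins⁺ k (arc-label l p)))
    ... | inj₂ p = Equivalence.from (T-∨ {joins (toℕ a) (toℕ b) k}) (inj₂ (arc⇒edgeGraph ls p))

  -- Each vertex is sent to its position in `xs`: distinctness makes positions unambiguous, the
  -- length fixes their range, and `Labels` matches arcs with labelled edges.
  layout-iso : ∀ {m N} {G : Graph m} {ι : Fin m → V} {xs ks es} → Presents G ι (pts xs ⊕ edgesˢ es) →
               length xs ≡ N → Pointwise (Labels xs) ks es → Iso G (edgeGraph N ks)
  layout-iso {m} {N} {G} {ι} {xs} {ks} {es} P len labels = mk⤖ (to-injective , to-surjective) , adj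
    where
    open Presents P
    verts≡ : verts (pts xs ⊕ edgesˢ es) ≡ xs
    verts≡ = trans (cong (xs ++_) (edges-no-verts es)) (++-identityʳ xs)
    uniq : Unique xs
    uniq = subst Unique verts≡ unique

    at : ∀ a → ∃ λ i → At xs i (ι a)
    at a = ∈⇒At (subst (ι a ∈_) verts≡ (covered a))

    to : Fin m → Fin N
    to a = fromℕ< (subst (_ <_) len (At⇒< (proj₂ (at a))))

    to-at : ∀ a → At xs (toℕ (to a)) (ι a)
    to-at a = subst (λ i → At xs i (ι a)) (sym (toℕ-fromℕ< _)) (proj₂ (at a))

    to-injective : ∀ {a b} → to a ≡ to b → a ≡ b
    to-injective {a} {b} eq = injective (At-functional (to-at a) (subst (λ c → At xs (toℕ c) (ι b)) (sym eq) (to-at b)))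

    to-surjective : ∀ c → ∃ λ a → ∀ {b} → b ≡ a → to b ≡ c
    to-surjective c with <⇒At xs (subst (toℕ c <_) (sym len) (toℕ<n c))
    ... | v , p with onto (subst (v ∈_) (sym verts≡) (At⇒∈ p))
    ...   | a , refl = a , λ { refl → toℕ-injective (At-injective uniq (to-at a) p) }

    adj : ∀ a b → G a b ≡ edgeGraph N ks (to a) (to b)
    adj a b = T-ext
      (λ t → arc⇒edgeGraph uniq (to-at a) (to-at b) labels (adj⇒arc t))
      (λ t → arc⇒adj (edgeGraph⇒arc uniq (to-at a) (to-at b) labels t))

-- pendants uses a where-bound function that cannot be named outside Defs; unification with
-- the field block makes it available for case analysis.
record Blocks (ks : List (ℕ × ℕ)) (r : ℕ) : Set where
  field
    block  : Fin r → List (ℕ × ℕ)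
    blocks : ks ≡ concat (map block (allFin r))

pendants-blocks : ∀ base p q r c → Blocks (pendants base p q r c) r
pendants-blocks base p q r c = record { block = _ ; blocks = refl }

pendant-block : ∀ base p q r c i → Blocks.block (pendants-blocks base p q r c) i
  ≡ (base + toℕ i , base + r + toℕ i) ∷ ((if c i then p else q) , base + toℕ i) ∷ []
pendant-block base p q r c i with c i
... | true  = refl
... | false = refl

-- Coloured legs and their numbering

module _ {V : Set} where

  open CommutativeMonoid (shapes V) using (setoid; ∙-congˡ; ∙-congʳ; identityʳ)
  open CommutativeMonoidSolver (shapes V) using (solve; _⊜_) renaming (_⊕_ to _⊞_; id to ∅)
  open import Relation.Binary.Reasoning.Setoid setoid

  -- A leg whose colour tells at which of two hubs it hangs, as in `pendants`.
  Limb : Set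
  Limb = Bool × V × V

  joint tip : Limb → V
  joint (_ , x , _) = x
  tip   (_ , _ , y) = y

  limbs : (Bool → V) → List Limb → Shape
  limbs h []                 = ε
  limbs h ((c , x , y) ∷ ls) = leg (h c) (x , y) ⊕ limbs h ls

  -- All joints precede all tips, in agreement with the labels `base + i` and `base + r + i`.
  ends : List Limb → List V
  ends ls = map joint ls ++ map tip ls

  joint-at : ∀ ls i → At (ends ls) (toℕ i) (joint (lookup ls i))
  joint-at ls i = At-++ˡ (At-map-lookup joint ls i)

  tip-at : ∀ ls i → At (ends ls) (length ls + toℕ i) (tip (lookup ls i))
  tip-at ls i = subst (λ k → At (ends ls) (k + toℕ i) (tip (lookup ls i))) (length-map joint ls) (At-++ʳ (map joint ls) (At-map-lookup tip ls i))

  length-ends : ∀ ls → length (ends ls) ≡ length ls + length ls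
  length-ends ls = trans (length-++ (map joint ls)) (cong₂ _+_ (length-map joint ls) (length-map tip ls))

  edgesˢ-++ : ∀ es fs → edgesˢ (es ++ fs) ≈ edgesˢ es ⊕ edgesˢ fs
  edgesˢ-++ []             fs = ≈-refl
  edgesˢ-++ ((a , b) ∷ es) fs = ≈-trans (∙-congˡ {link a b} (edgesˢ-++ es fs))
    (≈-sym (CommutativeMonoid.assoc (shapes V) (link a b) (edgesˢ es) (edgesˢ fs)))

  pts-++ : ∀ (xs ys : List V) → pts (xs ++ ys) ≈ pts xs ⊕ pts ys
  pts-++ xs ys = ↭-refl , ↭-refl

  -- The parameter `F` is there because `spider` and `pendants` list the two edges of a leg in
  -- different orders.
  limbs-layout : ∀ h (F : Limb → List (V × V)) →
    (∀ c x y → edgesˢ (F (c , x , y)) ≈ link (h c) x ⊕ link x y) →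
    ∀ ls → limbs h ls ≈ pts (ends ls) ⊕ edgesˢ (concat (map F ls))
  limbs-layout h F F≈ ls = ≈-trans (go ls) (∙-congʳ {edgesˢ (concat (map F ls))} (≈-sym (pts-++ (map joint ls) (map tip ls))))
    where
    go : ∀ ls → limbs h ls ≈ (pts (map joint ls) ⊕ pts (map tip ls)) ⊕ edgesˢ (concat (map F ls))
    go [] = ≈-refl
    go ((c , x , y) ∷ ls) = begin
      (link (h c) x ⊕ (pt x ⊕ (link x y ⊕ pt y))) ⊕ limbs h ls
        ≈⟨ ∙-congˡ {leg (h c) (x , y)} (go ls) ⟩
      (link (h c) x ⊕ (pt x ⊕ (link x y ⊕ pt y))) ⊕ ((pts (map joint ls) ⊕ pts (map tip ls)) ⊕ E)
        ≈⟨ solve 7 (λ k x l y X Y E → (k ⊞ (x ⊞ (l ⊞ y))) ⊞ ((X ⊞ Y) ⊞ E) ⊜ ((x ⊞ X) ⊞ (y ⊞ Y)) ⊞ ((k ⊞ l) ⊞ E)) ≈-refl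
             (link (h c) x) (pt x) (link x y) (pt y) (pts (map joint ls)) (pts (map tip ls)) E ⟩
      P ⊕ ((link (h c) x ⊕ link x y) ⊕ E)
        ≈⟨ ∙-congˡ {P} (∙-congʳ {E} (F≈ c x y)) ⟨
      P ⊕ (edgesˢ (F (c , x , y)) ⊕ E)
        ≈⟨ ∙-congˡ {P} (edgesˢ-++ (F (c , x , y)) (concat (map F ls))) ⟨
      P ⊕ edgesˢ (concat (map F ((c , x , y) ∷ ls))) ∎
      where
      E = edgesˢ (concat (map F ls))
      P = pts (map joint ((c , x , y) ∷ ls)) ⊕ pts (map tip ((c , x , y) ∷ ls))

  limbs-labels : ∀ {xs} (F : Limb → List (V × V)) ls (f : Fin (length ls) → List (ℕ × ℕ)) →
    (∀ i → Pointwise (Labels xs) (f i) (F (lookup ls i))) →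
    Pointwise (Labels xs) (concat (map f (allFin (length ls)))) (concat (map F ls))
  limbs-labels {xs} F ls f labels =
    subst (λ es → Pointwise (Labels xs) (concat (map f (allFin (length ls)))) (concat es)) eq (go (allFin (length ls)))
    where
    go : ∀ is → Pointwise (Labels xs) (concat (map f is)) (concat (map (F ∘ lookup ls) is))
    go []       = []
    go (i ∷ is) = Pointwise-++⁺ (labels i) (go is)
    eq : map (F ∘ lookup ls) (allFin (length ls)) ≡ map F ls
    eq = trans (map-tabulate (λ i → i) (F ∘ lookup ls))
         (trans (sym (map-tabulate (lookup ls) F)) (cong (map F) (tabulate-lookup ls)))

  paint : List (V × V) → List (V × V) → List Limb
  paint ls ms = map (true ,_) ls ++ map (false ,_) ms

  colours : List (V × V) → List (V × V) → ∃ λ r → Fin r → Bool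
  colours ls ms = length (paint ls ms) , proj₁ ∘ lookup (paint ls ms)

  limbs-paint : ∀ h ls ms → limbs h (paint ls ms) ≈ legs (h true) ls ⊕ legs (h false) ms
  limbs-paint h []       []       = ≈-refl
  limbs-paint h []       (m ∷ ms) = ∙-congˡ {leg (h false) m} (limbs-paint h [] ms)
  limbs-paint h (l ∷ ls) ms       = ≈-trans (∙-congˡ {leg (h true) l} (limbs-paint h ls ms))
    (≈-sym (CommutativeMonoid.assoc (shapes V) (leg (h true) l) (legs (h true) ls) (legs (h false) ms)))

  pendant-edges : (Bool → V) → Limb → List (V × V)
  pendant-edges h (c , x , y) = (x , y) ∷ (h c , x) ∷ []

  pendants-layout : ∀ h ls → limbs h ls ≈ pts (ends ls) ⊕ edgesˢ (concat (map (pendant-edges h) ls))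
  pendants-layout h = limbs-layout h (pendant-edges h)
    λ c x y → solve 2 (λ k l → l ⊞ (k ⊞ ∅) ⊜ k ⊞ l) ≈-refl (link (h c) x) (link x y)

  pendants-labels : ∀ {xs} h ls base p q → At xs p (h true) → At xs q (h false) →
    (∀ i → At xs (base + toℕ i) (joint (lookup ls i))) →
    (∀ i → At xs (base + length ls + toℕ i) (tip (lookup ls i))) →
    Pointwise (Labels xs) (pendants base p q (length ls) (proj₁ ∘ lookup ls)) (concat (map (pendant-edges h) ls))
  pendants-labels {xs} h ls base p q p↦ q↦ joint↦ tip↦ =
    subst (λ ks → Pointwise (Labels xs) ks (concat (map (pendant-edges h) ls))) (sym (Blocks.blocks B)) (limbs-labels (pendant-edges h) ls (Blocks.block B) labels)
    where
    c = proj₁ ∘ lookup ls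
    B = pendants-blocks base p q (length ls) c
    hub : ∀ b → At xs (if b then p else q) (h b)
    hub true  = p↦
    hub false = q↦
    labels : ∀ i → Pointwise (Labels xs) (Blocks.block B i) (pendant-edges h (lookup ls i))
    labels i = subst (λ ks → Pointwise (Labels xs) ks (pendant-edges h (lookup ls i))) (sym (pendant-block base p q (length ls) c i))
      (forth (joint↦ i) (tip↦ i) ∷ forth (hub (c i)) (joint↦ i) ∷ [])

applyUpTo≡tabulate : ∀ {A : Set} (f : ℕ → A) k → applyUpTo f k ≡ tabulate {n = k} (f ∘ toℕ)
applyUpTo≡tabulate f zero    = refl
applyUpTo≡tabulate f (suc k) = cong (f 0 ∷_) (applyUpTo≡tabulate (f ∘ suc) k)

map-upTo≡map-allFin : ∀ {A : Set} (f : ℕ → A) k → map f (upTo k) ≡ map (f ∘ toℕ) (allFin k)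
map-upTo≡map-allFin f k = trans (cong (map f) (applyUpTo≡tabulate (λ i → i) k))
  (trans (map-tabulate toℕ f) (sym (map-tabulate (λ i → i) (f ∘ toℕ))))

pattern at₀ = here
pattern at₁ = there at₀
pattern at₂ = there at₁
pattern at₃ = there at₂
pattern at₄ = there at₃
pattern at₅ = there at₄
pattern at₆ = there at₅
pattern at₇ = there at₆

-- Isomorphisms with spiders, the three families and the small trees

module _ {m} {V : Set} {G : Graph m} {ι : Fin m → V} where

  open CommutativeMonoid (shapes V) using (setoid; ∙-congˡ; identityʳ)
  open CommutativeMonoidSolver (shapes V) using (solve; _⊜_) renaming (_⊕_ to _⊞_; id to ∅)
  open import Relation.Binary.Reasoning.Setoid setoid

  spider-iso : ∀ {v} ls → Presents G ι (spiderˢ v ls) → Iso G (spider (length ls))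
  spider-iso {v} ls₀ P = subst (λ k → Iso G (spider k)) len
    (layout-iso {xs = v ∷ ends ls} (Presents-resp layout P) size (forth-labels))
    where
    ls : List (Limb {V})
    -- All legs hang at the one centre, so a single colour lets the coloured layout be reused.
    ls = paint ls₀ []
    colour : V × V → Limb
    colour l = true , l
    len : length ls ≡ length ls₀
    len = trans (cong length (++-identityʳ (map colour ls₀))) (length-map colour ls₀)
    F : Limb → List (V × V)
    F (_ , x , y) = (v , x) ∷ (x , y) ∷ []
    k = length ls
    size : length (v ∷ ends ls) ≡ 2 * k + 1
    size = trans (cong suc (length-ends ls)) (ℕ-solve 1 (λ k → con 1 :+ (k :+ k) := con 2 :* k :+ con 1) refl k)
      where open +-*-Solver using (con; _:*_; _:+_; _:=_) renaming (solve to ℕ-solve)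
    f : ℕ → List (ℕ × ℕ)
    f i = (0 , suc i) ∷ (suc i , suc (k + i)) ∷ []
    forth-labels : Pointwise (Labels (v ∷ ends ls)) (concat (map f (upTo k))) (concat (map F ls))
    forth-labels = subst (λ ks → Pointwise (Labels (v ∷ ends ls)) (concat ks) (concat (map F ls))) (sym (map-upTo≡map-allFin f k))
      (limbs-labels F ls (f ∘ toℕ) λ i → forth here (there (joint-at ls i)) ∷ forth (there (joint-at ls i)) (there (tip-at ls i)) ∷ [])
    layout : spiderˢ v ls₀ ≈ pts (v ∷ ends ls) ⊕ edgesˢ (concat (map F ls))
    layout = begin
      pt v ⊕ legs v ls₀        ≈⟨ ∙-congˡ {pt v} (identityʳ (legs v ls₀)) ⟨
      pt v ⊕ (legs v ls₀ ⊕ ε)  ≈⟨ ∙-congˡ {pt v} (limbs-paint (λ _ → v) ls₀ []) ⟨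
      pt v ⊕ limbs (λ _ → v) ls
        ≈⟨ ∙-congˡ {pt v} (limbs-layout (λ _ → v) F (λ c x y → ∙-congˡ {link v x} (identityʳ (link x y))) ls) ⟩
      pt v ⊕ (pts (ends ls) ⊕ edgesˢ (concat (map F ls)))
        ≈⟨ CommutativeMonoid.assoc (shapes V) (pt v) (pts (ends ls)) (edgesˢ (concat (map F ls))) ⟨
      pts (v ∷ ends ls) ⊕ edgesˢ (concat (map F ls)) ∎

  -- `us` and `cs` form the fixed part of a family; the remaining legs at `v` and `w` become the
  -- pendants at labels `p` and `q`.
  core-iso : ∀ {s v w p q} us cs {ks} ls ms → let (r , c) = colours ls ms in
    s ≈ pts us ⊕ (edgesˢ cs ⊕ (legs v ls ⊕ legs w ms)) → Presents G ι s →
    Pointwise (Labels us) ks cs → At us p v → At us q w →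
    Iso G (edgeGraph (length us + r + r) (ks ++ pendants (length us) p q r c))
  core-iso {s} {v} {w} {p} {q} us cs ls ms s≈ P labels p↦v q↦w =
    layout-iso {xs = us ++ ends L} {es = cs ++ es} (Presents-resp layout P)
      (trans (length-++ us) (trans (cong (length us +_) (length-ends L)) (sym (+-assoc (length us) (length L) (length L)))))
      (Pointwise-++⁺ (Pointwise-map Labels-++ labels)
        (pendants-labels h L (length us) p q (At-++ˡ p↦v) (At-++ˡ q↦w)
          (λ i → At-++ʳ us (joint-at L i))
          (λ i → subst (λ k → At (us ++ ends L) k (tip (lookup L i))) (sym (+-assoc (length us) (length L) (toℕ i)))
                   (At-++ʳ us (tip-at L i)))))
    where
    L : List Limb
    L = paint ls ms
    h : Bool → V
    h b = if b then v else w
    es = concat (map (pendant-edges h) L)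
    layout : s ≈ pts (us ++ ends L) ⊕ edgesˢ (cs ++ es)
    layout = begin
      s
        ≈⟨ s≈ ⟩
      pts us ⊕ (edgesˢ cs ⊕ (legs v ls ⊕ legs w ms))
        ≈⟨ ∙-congˡ {pts us} (∙-congˡ {edgesˢ cs} (≈-trans (≈-sym (limbs-paint h ls ms)) (pendants-layout h L))) ⟩
      pts us ⊕ (edgesˢ cs ⊕ (pts (ends L) ⊕ edgesˢ es))
        ≈⟨ solve 4 (λ A B P E → A ⊞ (B ⊞ (P ⊞ E)) ⊜ (A ⊞ P) ⊞ (B ⊞ E)) ≈-refl (pts us) (edgesˢ cs) (pts (ends L)) (edgesˢ es) ⟩
      (pts us ⊕ pts (ends L)) ⊕ (edgesˢ cs ⊕ edgesˢ es)
        ≈⟨ ⊕-cong (pts-++ us (ends L)) (edgesˢ-++ cs es) ⟨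
      pts (us ++ ends L) ⊕ edgesˢ (cs ++ es) ∎

  -- The first leg of each centre, with the link between the centres, is the path u₀ to u₅; the
  -- centres are u₂ and u₃.
  familyA-iso : ∀ v l ls w m ms → let (r , c) = colours ls ms in
    Presents G ι (spiderˢ v (l ∷ ls) ⊕ (link v w ⊕ spiderˢ w (m ∷ ms))) → Iso G (familyA r c)
  familyA-iso v (x , y) ls w (x′ , y′) ms P = core-iso
    (y ∷ x ∷ v ∷ w ∷ x′ ∷ y′ ∷ [])
    ((x , y) ∷ (v , x) ∷ (v , w) ∷ (w , x′) ∷ (x′ , y′) ∷ []) ls ms
    (solve 13 (λ v a x b y l c q d w e z m →
       (v ⊞ ((a ⊞ (x ⊞ (b ⊞ y))) ⊞ l)) ⊞ (c ⊞ (q ⊞ ((d ⊞ (w ⊞ (e ⊞ z))) ⊞ m)))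
       ⊜ (y ⊞ (x ⊞ (v ⊞ (q ⊞ (w ⊞ z))))) ⊞ ((b ⊞ (a ⊞ (c ⊞ (d ⊞ (e ⊞ ∅))))) ⊞ (l ⊞ m))) ≈-refl
       (pt v) (link v x) (pt x) (link x y) (pt y) (legs v ls) (link v w)
       (pt w) (link w x′) (pt x′) (link x′ y′) (pt y′) (legs w ms))
    P
    -- Links of a leg run outwards from its centre, whereas the path enters the first leg at its
    -- tip; hence two `back`s.
    (back at₀ at₁ ∷ back at₁ at₂ ∷ forth at₂ at₃ ∷ forth at₃ at₄ ∷ forth at₄ at₅ ∷ [])
    at₂ at₃

  familyB-iso : ∀ v l ls u t w m ms → let (r , c) = colours ls ms in
    Presents G ι (spiderˢ v (l ∷ ls) ⊕ ((link v u ⊕ (pt u ⊕ (link u t ⊕ pt t))) ⊕ (link u w ⊕ spiderˢ w (m ∷ ms)))) →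
    Iso G (familyB r c)
  familyB-iso v (x , y) ls u t w (x′ , y′) ms P = core-iso
    -- The extra leaf `t` at u₃ comes last, since its label is 7.
    (y ∷ x ∷ v ∷ u ∷ w ∷ x′ ∷ y′ ∷ t ∷ [])
    ((x , y) ∷ (v , x) ∷ (v , u) ∷ (u , w) ∷ (w , x′) ∷ (x′ , y′) ∷ (u , t) ∷ []) ls ms
    (solve 17 (λ v a x b y l f u g t c q d w e z m →
       (v ⊞ ((a ⊞ (x ⊞ (b ⊞ y))) ⊞ l)) ⊞ ((f ⊞ (u ⊞ (g ⊞ t))) ⊞ (c ⊞ (q ⊞ ((d ⊞ (w ⊞ (e ⊞ z))) ⊞ m))))
       ⊜ (y ⊞ (x ⊞ (v ⊞ (u ⊞ (q ⊞ (w ⊞ (z ⊞ t))))))) ⊞ ((b ⊞ (a ⊞ (f ⊞ (c ⊞ (d ⊞ (e ⊞ (g ⊞ ∅))))))) ⊞ (l ⊞ m))) ≈-refl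
       (pt v) (link v x) (pt x) (link x y) (pt y) (legs v ls) (link v u) (pt u) (link u t) (pt t) (link u w)
       (pt w) (link w x′) (pt x′) (link x′ y′) (pt y′) (legs w ms))
    P
    (back at₀ at₁ ∷ back at₁ at₂ ∷ forth at₂ at₃ ∷ forth at₃ at₄ ∷ forth at₄ at₅ ∷ forth at₅ at₆ ∷ forth at₃ at₇ ∷ [])
    at₂ at₄

  familyC-iso : ∀ v l ls a b w m ms → let (r , c) = colours ls ms in
    Presents G ι (spiderˢ v (l ∷ ls) ⊕ ((link v a ⊕ (pt a ⊕ (link a b ⊕ pt b))) ⊕ (link b w ⊕ spiderˢ w (m ∷ ms)))) →
    Iso G (familyC r c)
  familyC-iso v (x , y) ls a b w (x′ , y′) ms P = core-iso
    (y ∷ x ∷ v ∷ a ∷ b ∷ w ∷ x′ ∷ y′ ∷ [])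
    ((x , y) ∷ (v , x) ∷ (v , a) ∷ (a , b) ∷ (b , w) ∷ (w , x′) ∷ (x′ , y′) ∷ []) ls ms
    (solve 17 (λ v a x b y l f u g t c q d w e z m →
       (v ⊞ ((a ⊞ (x ⊞ (b ⊞ y))) ⊞ l)) ⊞ ((f ⊞ (u ⊞ (g ⊞ t))) ⊞ (c ⊞ (q ⊞ ((d ⊞ (w ⊞ (e ⊞ z))) ⊞ m))))
       ⊜ (y ⊞ (x ⊞ (v ⊞ (u ⊞ (t ⊞ (q ⊞ (w ⊞ z))))))) ⊞ ((b ⊞ (a ⊞ (f ⊞ (g ⊞ (c ⊞ (d ⊞ (e ⊞ ∅))))))) ⊞ (l ⊞ m))) ≈-refl
       (pt v) (link v x) (pt x) (link x y) (pt y) (legs v ls) (link v a) (pt a) (link a b) (pt b) (link b w)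
       (pt w) (link w x′) (pt x′) (link x′ y′) (pt y′) (legs w ms))
    P
    (back at₀ at₁ ∷ back at₁ at₂ ∷ forth at₂ at₃ ∷ forth at₃ at₄ ∷ forth at₄ at₅ ∷ forth at₅ at₆ ∷ forth at₆ at₇ ∷ [])
    at₂ at₅

  path₃-iso : ∀ {v x y} → Presents G ι (spiderˢ v ((x , y) ∷ [])) → Iso G (pathGraph 3)
  path₃-iso {v} {x} {y} P = layout-iso {xs = v ∷ x ∷ y ∷ []} {es = (v , x) ∷ (x , y) ∷ []}
    (Presents-resp (solve 5 (λ v a x b y → v ⊞ ((a ⊞ (x ⊞ (b ⊞ y))) ⊞ ∅) ⊜ (v ⊞ (x ⊞ y)) ⊞ (a ⊞ (b ⊞ ∅))) ≈-refl
      (pt v) (link v x) (pt x) (link x y) (pt y)) P)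
    refl (forth at₀ at₁ ∷ forth at₁ at₂ ∷ [])

  path₄-iso : ∀ {v x y q} → Presents G ι (spiderˢ v ((x , y) ∷ []) ⊕ (link v q ⊕ pt q)) → Iso G (pathGraph 4)
  path₄-iso {v} {x} {y} {q} P = layout-iso {xs = q ∷ v ∷ x ∷ y ∷ []} {es = (v , q) ∷ (v , x) ∷ (x , y) ∷ []}
    (Presents-resp (solve 7 (λ v a x b y c q → (v ⊞ ((a ⊞ (x ⊞ (b ⊞ y))) ⊞ ∅)) ⊞ (c ⊞ q)
        ⊜ (q ⊞ (v ⊞ (x ⊞ y))) ⊞ (c ⊞ (a ⊞ (b ⊞ ∅)))) ≈-refl
      (pt v) (link v x) (pt x) (link x y) (pt y) (link v q) (pt q)) P)
    refl (back at₀ at₁ ∷ forth at₁ at₂ ∷ forth at₂ at₃ ∷ [])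

  star₁₃-iso : ∀ {v u w q} → Presents G ι (spiderˢ v [] ⊕ ((link v u ⊕ (pt u ⊕ (link u w ⊕ pt w))) ⊕ (link u q ⊕ pt q))) → Iso G star13
  star₁₃-iso {v} {u} {w} {q} P = layout-iso {xs = u ∷ v ∷ w ∷ q ∷ []} {es = (v , u) ∷ (u , w) ∷ (u , q) ∷ []}
    (Presents-resp (solve 7 (λ v a u b w c q → (v ⊞ ∅) ⊞ ((a ⊞ (u ⊞ (b ⊞ w))) ⊞ (c ⊞ q))
        ⊜ (u ⊞ (v ⊞ (w ⊞ q))) ⊞ (a ⊞ (b ⊞ (c ⊞ ∅)))) ≈-refl
      (pt v) (link v u) (pt u) (link u w) (pt w) (link u q) (pt q)) P)
    refl (back at₀ at₁ ∷ forth at₀ at₂ ∷ forth at₀ at₃ ∷ [])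

-- Removing a leaf

PresentsSelf : ∀ {n} → Graph n → Shape → Set
PresentsSelf G s = Presents G (λ a → a) s

module _ {V : Set} where

  -- A shape may contain arcs whose ends are not among its vertices; this excludes them.
  Closed : Shape {V} → Set
  Closed s = All (λ e → proj₁ e ∈ verts s × proj₂ e ∈ verts s) (arcs s)

  spiderˢ-closed : ∀ v ls → Closed (spiderˢ v ls)
  spiderˢ-closed v [] = []
  spiderˢ-closed v ((x , y) ∷ ls) =
    (here refl , there (here refl)) ∷ (there (here refl) , here refl) ∷
    (there (here refl) , there (there (here refl))) ∷ (there (there (here refl)) , there (here refl)) ∷
    All.map (λ (p , q) → insert p , insert q) (spiderˢ-closed v ls)
    where
    insert : ∀ {a} → a ∈ verts (spiderˢ v ls) → a ∈ verts (spiderˢ v ((x , y) ∷ ls))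
    insert (here p)  = here p
    insert (there p) = there (there (there p))

  size-legs : ∀ (v : V) ls → length (verts (legs v ls)) ≡ length ls * 2
  size-legs v []       = refl
  size-legs v (l ∷ ls) = cong (2 +_) (size-legs v ls)

  size-spider-⊕ : ∀ (v : V) ls t → length (verts (spiderˢ v ls ⊕ t)) ≡ suc (length ls * 2 + length (verts t))
  size-spider-⊕ v ls t = trans (length-++ (verts (spiderˢ v ls))) (cong (λ k → suc (k + length (verts t))) (size-legs v ls))

module _ {m} {T : Graph (suc m)} {t u w} (closed : Closed t) (P : PresentsSelf T (t ⊕ (link u w ⊕ pt w))) where

  open Presents P

  w∉ : w ∉ verts t
  w∉ w∈ = Unique[x∷xs]⇒x∉xs (Unique-resp-↭ (++-comm (verts t) (w ∷ [])) unique) w∈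

  arc-cases : ∀ {a b} → (a , b) ∈ arcs (t ⊕ (link u w ⊕ pt w)) → (a , b) ∈ arcs t ⊎ (a ≡ w × b ≡ u) ⊎ (a ≡ u × b ≡ w)
  arc-cases ab∈ with ∈-++⁻ (arcs t) ab∈
  ... | inj₁ p = inj₁ p
  ... | inj₂ (here refl) = inj₂ (inj₂ (refl , refl))
  ... | inj₂ (there (here refl)) = inj₂ (inj₁ (refl , refl))

  -- A further arc at `w` would lie in `t`, and closedness would make `w` a vertex of `t`, against
  -- distinctness.
  leaf : IsLeaf T w
  leaf = u , arc⇒adj (∈-++⁺ʳ (arcs t) (there (here refl))) , λ v wv → only (arc-cases (adj⇒arc wv))
    where
    only : ∀ {v} → (w , v) ∈ arcs t ⊎ (w ≡ w × v ≡ u) ⊎ (w ≡ u × v ≡ w) → v ≡ u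
    only (inj₁ p)                  = contradiction (proj₁ (All.lookup closed p)) w∉
    only (inj₂ (inj₁ (_ , v≡u)))   = v≡u
    only (inj₂ (inj₂ (w≡u , v≡w))) = trans v≡w w≡u

  remove-leaf : Presents (removeVertex T w) (punchIn w) t
  remove-leaf = record
    { injective = punchIn-injective w _ _
    ; unique    = Unique-resp-⊑ (++⁺ʳ (w ∷ []) ⊆-refl) unique
    ; covered   = λ a → old a (covered (punchIn w a))
    ; onto      = λ {v} v∈ → let w≢v = λ { refl → w∉ v∈ } in punchOut w≢v , punchIn-punchOut w≢v
    ; adj⇒arc   = λ {a} {b} ab → new a b (arc-cases (adj⇒arc ab))
    ; arc⇒adj   = λ ab∈ → arc⇒adj (∈-++⁺ˡ ab∈)
    }
    where
    old : ∀ a → punchIn w a ∈ verts (t ⊕ (link u w ⊕ pt w)) → punchIn w a ∈ verts t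
    old a a∈ with ∈-++⁻ (verts t) a∈
    ... | inj₁ p = p
    ... | inj₂ (here eq) = contradiction eq (punchInᵢ≢i w a)
    new : ∀ a b → _ → (punchIn w a , punchIn w b) ∈ arcs t
    new a b (inj₁ p)                = p
    new a b (inj₂ (inj₁ (eq , _)))  = contradiction eq (punchInᵢ≢i w a)
    new a b (inj₂ (inj₂ (_ , eq)))  = contradiction eq (punchInᵢ≢i w b)

-- Upper bounds on the diameter

module _ {n} {G : Graph n} where

  _++ʷ_ : ∀ {u v w j k} → Walk G u v j → Walk G v w k → Walk G u w (j + k)
  nil      ++ʷ q = q
  cons e p ++ʷ q = cons e (p ++ʷ q)

  reverseʷ : IsSimple G → ∀ {u v k} → Walk G u v k → Walk G v u k
  reverseʷ simple nil = nil
  reverseʷ simple (cons {k = k} e p) =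
    subst (Walk G _ _) (+-comm k 1) (reverseʷ simple p ++ʷ cons (adj-sym simple e) nil)

  diameter-≤4 : IsSimple G → ∀ v → (∀ a → DistLe G v a 2) → DiamLe G 4
  diameter-≤4 simple v near a b = let (j , j≤ , p) = near a ; (k , k≤ , q) = near b in
    j + k , +-mono-≤ j≤ k≤ , reverseʷ simple p ++ʷ q

  legs-near : ∀ v ls → All (AdjPair G) (arcs (legs v ls)) → All (λ a → DistLe G v a 2) (verts (legs v ls))
  legs-near v [] _ = []
  legs-near v (l ∷ ls) (vx ∷ _ ∷ xy ∷ _ ∷ adj) =
    (1 , s≤s z≤n , cons vx nil) ∷ (2 , ≤-refl , cons vx (cons xy nil)) ∷ legs-near v ls adj

  spider-near : ∀ v ls → All (AdjPair G) (arcs (spiderˢ v ls)) → All (λ a → DistLe G v a 2) (verts (spiderˢ v ls))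
  spider-near v ls adj = (0 , z≤n , nil) ∷ legs-near v ls adj

-- Lower bounds on the diameter

Lipschitz : (ℕ → ℕ) → ℕ × ℕ → Set
Lipschitz g (i , j) = g i ≤ suc (g j) × g j ≤ suc (g i)

module _ {n N} {G : Graph n} {ks} (iso : Iso G (edgeGraph N ks)) (g : ℕ → ℕ) (lip : All (Lipschitz g) ks) where

  private
    to : Fin n → Fin N
    to = Bijection.to (proj₁ iso)

  edge-Lipschitz : ∀ {a b : Fin N} → IsTrue (edgeGraph N ks a b) → g (toℕ b) ≤ suc (g (toℕ a))
  edge-Lipschitz {a} {b} = go lip
    where
    go : ∀ {ks} → All (Lipschitz g) ks → IsTrue (edgeGraph N ks a b) → g (toℕ b) ≤ suc (g (toℕ a))
    go (_∷_ {x = e} (p , q) lip) t with Equivalence.to (T-∨ {joins (toℕ a) (toℕ b) e}) t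
    ... | inj₂ t′ = go lip t′
    ... | inj₁ t′ with joins⁻ e t′
    ...   | inj₁ (refl , refl) = q
    ...   | inj₂ (refl , refl) = p

  walk-Lipschitz : ∀ {a b k} → Walk G a b k → g (toℕ (to b)) ≤ k + g (toℕ (to a))
  walk-Lipschitz nil = ≤-refl
  walk-Lipschitz {a} (cons {v = v} {k = k} e p) = ≤-trans (walk-Lipschitz p)
    (≤-trans (+-monoʳ-≤ k (edge-Lipschitz {to a} {to v} (subst IsTrue (proj₂ iso a v) e)))
             (≤-reflexive (+-suc k _)))

  -- Along a walk the potential rises by at most the number of steps, so a rise of 5 excludes four
  -- steps.
  diameter-≰4 : ∀ a b → 5 + g (toℕ a) ≤ g (toℕ b) → ¬ DiamLe G 4
  diameter-≰4 a b far diam with Bijection.strictlySurjective (proj₁ iso) a | Bijection.strictlySurjective (proj₁ iso) b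
  ... | a′ , refl | b′ , refl with diam a′ b′
  ...   | k , k≤4 , p = <-irrefl refl (≤-trans far (≤-trans (walk-Lipschitz p) (+-monoˡ-≤ _ k≤4)))

pendants-Lipschitz : ∀ g base p q r c → (∀ i → Lipschitz g (base + toℕ i , base + r + toℕ i)) →
  (∀ i → Lipschitz g (p , base + toℕ i)) → (∀ i → Lipschitz g (q , base + toℕ i)) →
  All (Lipschitz g) (pendants base p q r c)
pendants-Lipschitz g base p q r c xy px qx =
  subst (All (Lipschitz g)) (sym (Blocks.blocks B)) (All.concat⁺ (All.map⁺ (All.universal block (allFin r))))
  where
  B = pendants-blocks base p q r c
  hub : ∀ b i → Lipschitz g ((if b then p else q) , base + toℕ i)
  hub true  = px
  hub false = qx
  block : ∀ i → All (Lipschitz g) (Blocks.block B i)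
  block i = subst (All (Lipschitz g)) (sym (pendant-block base p q r c i)) (xy i ∷ hub (c i) i ∷ [])

-- 1-Lipschitz potentials: along the path they rise from one end to the other, and they
-- are constant on the pendants, with a value at distance at most 1 from both attachment
-- vertices (which in family C forces a plateau at u₃, u₄).
levelA levelB levelC : ℕ → ℕ
levelA (suc (suc (suc (suc (suc (suc _)))))) = 2
levelA i = i
levelB (suc (suc (suc (suc (suc (suc (suc _))))))) = 3
levelB i = i
levelC 4 = 3
levelC 5 = 4
levelC 6 = 5
levelC 7 = 6
levelC (suc (suc (suc (suc (suc (suc (suc (suc _)))))))) = 3
levelC i = i

up : ∀ {k} → k ≤ suc (suc k) × suc k ≤ suc k
up = m≤n⇒m≤1+n (n≤1+n _) , ≤-refl

level : ∀ {k} → k ≤ suc k × k ≤ suc k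
level = n≤1+n _ , n≤1+n _

down : ∀ {k} → suc k ≤ suc k × k ≤ suc (suc k)
down = ≤-refl , m≤n⇒m≤1+n (n≤1+n _)

familyA-diameter : ∀ {n} {G : Graph n} r c → Iso G (familyA r c) → ¬ DiamLe G 4
familyA-diameter r c iso = diameter-≰4 {ks = pathEdges 6 ++ pendants 6 2 3 r c} iso levelA
  (up ∷ up ∷ up ∷ up ∷ up ∷ pendants-Lipschitz levelA 6 2 3 r c (λ _ → level) (λ _ → level) (λ _ → down))
  -- The ends of the path: their levels differ by exactly 5 here and by 6 in families B and C.
  (Fin.# 0) (Fin.# 5) ≤-refl

familyB-diameter : ∀ {n} {G : Graph n} r c → Iso G (familyB r c) → ¬ DiamLe G 4
familyB-diameter r c iso = diameter-≰4 {ks = pathEdges 7 ++ (3 , 7) ∷ pendants 8 2 4 r c} iso levelB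
  (up ∷ up ∷ up ∷ up ∷ up ∷ up ∷ level ∷ pendants-Lipschitz levelB 8 2 4 r c (λ _ → level) (λ _ → up) (λ _ → down))
  (Fin.# 0) (Fin.# 6) (n≤1+n 5)

familyC-diameter : ∀ {n} {G : Graph n} r c → Iso G (familyC r c) → ¬ DiamLe G 4
familyC-diameter r c iso = diameter-≰4 {ks = pathEdges 8 ++ pendants 8 2 5 r c} iso levelC
  (up ∷ up ∷ up ∷ level ∷ up ∷ up ∷ up ∷ pendants-Lipschitz levelC 8 2 5 r c (λ _ → level) (λ _ → up) (λ _ → down))
  (Fin.# 0) (Fin.# 7) (n≤1+n 5)

-- The conclusion for each class

Conclusion : ∀ n → Graph n → Set
Conclusion n T =
    (n ≤ 4 → Iso T (pathGraph n) ⊎ Iso T star13)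
  × (5 ≤ n → n % 2 ≡ 1 → Iso T (spider ((n ∸ 1) / 2)))
  × (6 ≤ n → n % 2 ≡ 0 → DiamLe T 4
      → ∃ λ (w : Fin n) → IsLeaf T w
          × ∃ λ (k : ℕ) → 2 ≤ k × Iso (removeVertex T w) (spider k))
  × (6 ≤ n → n % 2 ≡ 0 → DiamGt T 4
      → ∃ λ (r : ℕ) → ∃ λ (c : Fin r → Bool) →
          Iso T (familyA r c) ⊎ Iso T (familyB r c) ⊎ Iso T (familyC r c))

6+≰4 : ∀ {k} → ¬ 6 + k ≤ 4
6+≰4 (s≤s (s≤s (s≤s (s≤s ()))))

module _ {n} {T : Graph n} where

  odd-not-even : ∀ k → n ≡ 1 + k * 2 → n % 2 ≢ 0
  odd-not-even k eq even with trans (sym (trans (cong (_% 2) eq) ([m+kn]%n≡m%n 1 k 2))) even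
  ... | ()

  even-not-odd : ∀ k → n ≡ 0 + k * 2 → n % 2 ≢ 1
  even-not-odd k eq odd with trans (sym (trans (cong (_% 2) eq) ([m+kn]%n≡m%n 0 k 2))) odd
  ... | ()

  large : ∀ {k} {A : Set} → n ≡ 6 + k → n ≤ 4 → A
  large eq n≤4 = ⊥-elim (6+≰4 (subst (_≤ 4) eq n≤4))

  -- The order is even and at least 6 and the diameter exceeds 4, so the first three clauses hold
  -- vacuously.
  family-conclusion : ∀ k → n ≡ (3 + k) * 2 →
    ((r , c) : ∃ λ r → Fin r → Bool) → Iso T (familyA r c) ⊎ Iso T (familyB r c) ⊎ Iso T (familyC r c) → Conclusion n T
  family-conclusion k size (r , c) iso =
    large size , (λ _ odd → contradiction odd (even-not-odd (3 + k) size)) ,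
    (λ _ _ diam → ⊥-elim (wide iso diam)) , λ _ _ _ → r , c , iso
    where
    wide : Iso T (familyA r c) ⊎ Iso T (familyB r c) ⊎ Iso T (familyC r c) → ¬ DiamLe T 4
    wide (inj₁ i)        = familyA-diameter r c i
    wide (inj₂ (inj₁ i)) = familyB-diameter r c i
    wide (inj₂ (inj₂ i)) = familyC-diameter r c i

  spider-conclusion : ∀ {v} ls → 3 ≤ n → PresentsSelf T (spiderˢ v ls) → Conclusion n T
  spider-conclusion {v} ls 3≤n P = (λ n≤4 → inj₁ (small ls P size n≤4)) , (λ _ _ → iso) ,
    (λ _ even → contradiction even (odd-not-even (length ls) size)) ,
    (λ _ even → contradiction even (odd-not-even (length ls) size))
    where
    size : n ≡ 1 + length ls * 2
    size = trans (sym (order P)) (cong suc (size-legs v ls))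
    iso : Iso T (spider ((n ∸ 1) / 2))
    iso = subst (λ k → Iso T (spider k))
      (sym (trans (cong (λ k → (k ∸ 1) / 2) size) (m*n/n≡m (length ls) 2))) (spider-iso ls P)
    small : ∀ ls → PresentsSelf T (spiderˢ v ls) → n ≡ 1 + length ls * 2 → n ≤ 4 → Iso T (pathGraph n)
    small []            P eq _   = contradiction (subst (3 ≤_) eq 3≤n) λ { (s≤s ()) }
    small (_ ∷ [])      P eq _   = subst (λ k → Iso T (pathGraph k)) (sym eq) (path₃-iso P)
    small (_ ∷ _ ∷ ls)  P eq n≤4 = contradiction (subst (_≤ 4) eq n≤4) λ { (s≤s (s≤s (s≤s (s≤s ())))) }

-- Every vertex is within distance 2 of `v`, so the diameter is at most 4 and the last clause is
-- vacuous. With a single leg the tree is the path on four vertices.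
leaf-at-centre-conclusion : ∀ {m} {T : Graph (suc m)} {v} l ls {q} → IsSimple T →
  PresentsSelf T (spiderˢ v (l ∷ ls) ⊕ (link v q ⊕ pt q)) → Conclusion (suc m) T
leaf-at-centre-conclusion {m} {T} {v} l ls {q} simple P =
  small ls P size , (λ _ odd → contradiction odd (even-not-odd {T = T} (2 + length ls) size)) ,
  (λ 6≤n _ _ → q , leaf closed P , length (l ∷ ls) , two ls (subst (6 ≤_) size 6≤n) , spider-iso (l ∷ ls) (remove-leaf closed P)) ,
  (λ _ _ (a , b , far) → ⊥-elim (far (diameter-≤4 simple v near a b)))
  where
  closed = spiderˢ-closed v (l ∷ ls)
  size : suc m ≡ (2 + length ls) * 2
  size = trans (sym (order P)) (trans (size-spider-⊕ v (l ∷ ls) (link v q ⊕ pt q)) (cong (3 +_) (+-comm (length ls * 2) 1)))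
  small : ∀ ls → PresentsSelf T (spiderˢ v (l ∷ ls) ⊕ (link v q ⊕ pt q)) → suc m ≡ (2 + length ls) * 2 →
          suc m ≤ 4 → Iso T (pathGraph (suc m)) ⊎ Iso T star13
  small []       P eq _ = inj₁ (subst (λ k → Iso T (pathGraph k)) (sym eq) (path₄-iso P))
  small (_ ∷ ls) P eq   = large {T = T} eq
  -- Order at least 6 forces a second leg.
  two : ∀ ls → 6 ≤ (2 + length ls) * 2 → 2 ≤ suc (length ls)
  two []       6≤ = contradiction 6≤ 6+≰4
  two (_ ∷ ls) _  = s≤s (s≤s z≤n)
  adj : All (AdjPair T) (arcs (spiderˢ v (l ∷ ls) ⊕ (link v q ⊕ pt q)))
  adj = All.tabulate (Presents.arc⇒adj P)
  near : ∀ a → DistLe T v a 2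
  near a = All.lookup (All.++⁺ (spider-near v (l ∷ ls) (All.++⁻ˡ (arcs (spiderˢ v (l ∷ ls))) adj))
      ((1 , s≤s z≤n , cons (All.head (All.++⁻ʳ (arcs (spiderˢ v (l ∷ ls))) adj)) nil) ∷ []))
    (Presents.covered P a)

leaf-at-joint-conclusion : ∀ {m} {T : Graph (suc m)} {v} ls {u w q} → IsSimple T →
  PresentsSelf T (spiderˢ v ls ⊕ ((link v u ⊕ (pt u ⊕ (link u w ⊕ pt w))) ⊕ (link u q ⊕ pt q))) → Conclusion (suc m) T
leaf-at-joint-conclusion {m} {T} {v} ls {u} {w} {q} simple P =
  small ls P size , (λ _ odd → contradiction odd (even-not-odd {T = T} (2 + length ls) size)) ,
  (λ 6≤n _ _ → w , leaf closed P′ , length ((u , q) ∷ ls) , two ls (subst (6 ≤_) size 6≤n) ,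
    spider-iso ((u , q) ∷ ls) (remove-leaf closed P′)) ,
  (λ _ _ (a , b , far) → ⊥-elim (far (diameter-≤4 simple v near a b)))
  where
  open CommutativeMonoidSolver (shapes (Fin (suc m))) using (solve; _⊜_) renaming (_⊕_ to _⊞_)
  closed = spiderˢ-closed v ((u , q) ∷ ls)
  rest = (link v u ⊕ (pt u ⊕ (link u w ⊕ pt w))) ⊕ (link u q ⊕ pt q)
  -- Of the two leaves at `u`, `q` is regarded as the tip of a leg of the spider and `w` as the leaf
  -- to be removed.
  P′ : PresentsSelf T (spiderˢ v ((u , q) ∷ ls) ⊕ (link u w ⊕ pt w))
  P′ = Presents-resp (solve 8 (λ v ls a u b w c q →
         (v ⊞ ls) ⊞ ((a ⊞ (u ⊞ (b ⊞ w))) ⊞ (c ⊞ q)) ⊜ (v ⊞ ((a ⊞ (u ⊞ (c ⊞ q))) ⊞ ls)) ⊞ (b ⊞ w)) ≈-refl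
         (pt v) (legs v ls) (link v u) (pt u) (link u w) (pt w) (link u q) (pt q)) P
  size : suc m ≡ (2 + length ls) * 2
  size = trans (sym (order P)) (trans (size-spider-⊕ v ls rest) (cong suc (+-comm (length ls * 2) 3)))
  small : ∀ ls → PresentsSelf T (spiderˢ v ls ⊕ rest) → suc m ≡ (2 + length ls) * 2 →
          suc m ≤ 4 → Iso T (pathGraph (suc m)) ⊎ Iso T star13
  small []       P eq _ = inj₂ (star₁₃-iso P)
  small (_ ∷ ls) P eq   = large {T = T} eq
  two : ∀ ls → 6 ≤ (2 + length ls) * 2 → 2 ≤ suc (length ls)
  two []       6≤ = contradiction 6≤ 6+≰4
  two (_ ∷ ls) _  = s≤s (s≤s z≤n)
  adj : All (AdjPair T) (arcs (spiderˢ v ls ⊕ rest))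
  adj = All.tabulate (Presents.arc⇒adj P)
  near-rest : All (AdjPair T) (arcs rest) → All (λ a → DistLe T v a 2) (verts rest)
  near-rest (vu ∷ _ ∷ uw ∷ _ ∷ uq ∷ _) = (1 , s≤s z≤n , cons vu nil) ∷ (2 , ≤-refl , cons vu (cons uw nil))
    ∷ (2 , ≤-refl , cons vu (cons uq nil)) ∷ []
  near : ∀ a → DistLe T v a 2
  near a = All.lookup (All.++⁺ (spider-near v ls (All.++⁻ˡ (arcs (spiderˢ v ls)) adj)) (near-rest (All.++⁻ʳ (arcs (spiderˢ v ls)) adj)))
    (Presents.covered P a)

-- `t` is what lies between the two spiders: no vertices in family A, two in B and C. The sum
-- therefore computes to the form `(3 + k) * 2`.
size-joined : ∀ {n} {T : Graph n} v l ls t q k ms → PresentsSelf T (spiderˢ v (l ∷ ls) ⊕ (t ⊕ spiderˢ q (k ∷ ms))) →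
  n ≡ length (verts t) + (3 + (length ls + length ms)) * 2
size-joined {n} v l ls t q k ms P = begin
  n
    ≡⟨ order P ⟨
  length (verts (spiderˢ v (l ∷ ls) ⊕ (t ⊕ spiderˢ q (k ∷ ms))))
    ≡⟨ size-spider-⊕ v (l ∷ ls) (t ⊕ spiderˢ q (k ∷ ms)) ⟩
  3 + (length ls * 2 + length (verts t ++ verts (spiderˢ q (k ∷ ms))))
    ≡⟨ cong (λ j → 3 + (length ls * 2 + j)) (length-++ (verts t)) ⟩
  3 + (length ls * 2 + (length (verts t) + (3 + length (verts (legs q ms)))))
    ≡⟨ cong (λ j → 3 + (length ls * 2 + (length (verts t) + (3 + j)))) (size-legs q ms) ⟩
  3 + (length ls * 2 + (length (verts t) + (3 + length ms * 2)))
    ≡⟨ ℕ-solve 3 (λ a b t → con 3 :+ (a :* con 2 :+ (t :+ (con 3 :+ b :* con 2))) := t :+ (con 3 :+ (a :+ b)) :* con 2) refl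
         (length ls) (length ms) (length (verts t)) ⟩
  length (verts t) + (3 + (length ls + length ms)) * 2 ∎
  where
  open ≡-Reasoning
  open +-*-Solver using (con; _:*_; _:+_; _:=_) renaming (solve to ℕ-solve)

class-conclusion : ∀ {m} {T : Graph (suc m)} {s} → IsSimple T → 3 ≤ suc m → PresentsSelf T s → Class s → Conclusion (suc m) T
class-conclusion simple 3≤n P (is-spider v ls eq)  = spider-conclusion ls 3≤n (Presents-resp eq P)
class-conclusion simple 3≤n P (spider+leaf-at-centre v l ls q eq)  = leaf-at-centre-conclusion l ls simple (Presents-resp eq P)
class-conclusion simple 3≤n P (spider+leaf-at-joint v ls u w q eq) = leaf-at-joint-conclusion ls simple (Presents-resp eq P)
class-conclusion {m} {T} simple 3≤n P₀ (in-familyA v l ls q k ms eq) =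
  family-conclusion (length ls + length ms) (size-joined v l ls (link v q) q k ms P)
    (colours ls ms) (inj₁ (familyA-iso v l ls q k ms P))
  where P = Presents-resp eq P₀
class-conclusion {m} {T} simple 3≤n P₀ (in-familyB v l ls u w q k ms eq) =
  family-conclusion (1 + (length ls + length ms))
    (size-joined v l ls ((link v u ⊕ (pt u ⊕ (link u w ⊕ pt w))) ⊕ link u q) q k ms
      P)
    (colours ls ms) (inj₂ (inj₁ (familyB-iso v l ls u w q k ms P)))
  where P = Presents-resp eq P₀
class-conclusion {m} {T} simple 3≤n P₀ (in-familyC v l ls a b q k ms eq) =
  family-conclusion (1 + (length ls + length ms))
    (size-joined v l ls ((link v a ⊕ (pt a ⊕ (link a b ⊕ pt b))) ⊕ link b q) q k ms P)
    (colours ls ms) (inj₂ (inj₂ (familyC-iso v l ls a b q k ms P)))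
  where P = Presents-resp eq P₀

theorem7 : (n : ℕ) (T : Graph n) → IsTree T → 3 ≤ n
    → IsolationNumber (MidAdj T) ((n ∸ 1) / 2)
    → ((n ≤ 4 → Iso T (pathGraph n) ⊎ Iso T star13)
    × (5 ≤ n → n % 2 ≡ 1 → Iso T (spider ((n ∸ 1) / 2)))
    × (6 ≤ n → n % 2 ≡ 0 → DiamLe T 4
    → ∃ λ (w : Fin n) → IsLeaf T w
    × ∃ λ (k : ℕ) → 2 ≤ k × Iso (removeVertex T w) (spider k))
    × (6 ≤ n → n % 2 ≡ 0 → DiamGt T 4
    → ∃ λ (r : ℕ) → ∃ λ (c : Fin r → Bool) →
    Iso T (familyA r c) ⊎ Iso T (familyB r c) ⊎ Iso T (familyC r c)))
theorem7 (suc m) T isTree@(simple , _) 3≤n (_ , least) with tree-presentation isTree Fin.zero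
... | v , f , P with classify v f (subst (3 ≤_) (sym (order P)) 3≤n)
...   | inj₁ class = class-conclusion simple 3≤n P class
...   | inj₂ S     = ⊥-elim (no-surplus simple P least S)
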